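{- Let $m,n$ be positive integers. Then either $\Phi_m(q)\le\Phi_n(q)$ for all integers $q\ge 2$, or $\Phi_m(q)\ge\Phi_n(q)$ for all integers $q\ge2$.
   Context: For a positive integer $n$, $\Phi_n$ denotes the $n$-th cyclotomic polynomial, $\Phi_n(x)=\prod_{1\le a\le n,\ \gcd(a,n)=1}(x-\zeta_n^a)$, where $\zeta_n$ is a primitive $n$-th root of unity. -}

module Defs where

open import Algebra.Apartness.Bundles using (HeytingCommutativeRing; HeytingField)
open import Algebra.Bundles using (CommutativeRing)
import Algebra.Properties.Semiring.Exp
import Algebra.Properties.Semiring.Mult
open import Data.Integer.Base as ℤ using (ℤ; +_; -[1+_])
open import Data.List.Base using (List; applyUpTo; filter; foldr; map)
open import Data.Nat.Base as ℕ using (ℕ; suc)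
open import Data.Nat.GCD using (gcd)
open import Data.Nat.Properties using (_≟_)
open import Data.Product.Base using (_×_; ∃-syntax)
open import Relation.Nullary.Negation using (¬_)

-- A Heyting field is the constructive notion of field that ℂ satisfies
-- (nonzero is read as apart from zero); every field with decidable equality
-- is one as well.  K plays the role of an ambient field containing the roots
-- of unity.
module Cyclotomic {c ℓ₁ ℓ₂} (K : HeytingField c ℓ₁ ℓ₂) where

  open HeytingField K
  open HeytingCommutativeRing heytingCommutativeRing using (commutativeRing)
  open CommutativeRing commutativeRing using (semiring)
  open Algebra.Properties.Semiring.Exp semiring using (_^_)
  open Algebra.Properties.Semiring.Mult semiring using ()
    renaming (_×_ to _·_)

  ι : ℤ → Carrier
  ι (+ k)      = k · 1#
  ι (-[1+ k ]) = - (suc k · 1#)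

  CharacteristicZero : Set ℓ₁
  CharacteristicZero = ∀ k → ¬ (suc k · 1# ≈ 0#)

  record IsPrimitiveRoot (n : ℕ) (ζ : Carrier) : Set ℓ₁ where
    field
      ζⁿ≈1 : ζ ^ n ≈ 1#
      ζᵏ≉1 : ∀ k → 0 ℕ.< k → k ℕ.< n → ¬ (ζ ^ k ≈ 1#)

  -- The integers a with 1 ≤ a ≤ n and gcd(a, n) = 1.
  totatives : ℕ → List ℕ
  totatives n = filter (λ a → gcd a n ≟ 1) (applyUpTo suc n)

  -- Φ n ζ x is Φₙ(x), computed from the primitive n-th root of unity ζ.
  Φ : ℕ → Carrier → Carrier → Carrier
  Φ n ζ x = foldr _*_ 1# (map (λ a → x - ζ ^ a) (totatives n))

  -- K itself is not ordered.  The values Φₙ(q) at integers q are integers, and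
  -- are compared as such; that they are integers is part of the relation.
  -- In characteristic zero ι is injective, so the integers are unique.
  infix 4 _≤ᶻ_
  _≤ᶻ_ : Carrier → Carrier → Set ℓ₁
  x ≤ᶻ y = ∃[ i ] ∃[ j ] (x ≈ ι i × y ≈ ι j × i ℤ.≤ j)

{-# OPTIONS --safe #-}

-- Write n = t ∏ ps with ps the set of primes dividing n.  Then Φₙ(q) = q^φ(n) F
-- where F is a product of powers (1 - y^-d)^±1 with y = q^t and d running over
-- the divisors of ∏ ps.  The sign of the exponent of 1 - y^-d depends only on
-- the parities of the numbers of prime factors of d and of ∏ ps.
--
-- For y ≥ 2 one has 1 - y^-d ≤ (1 - y^-(d+1))².  Hence two products whose
-- exponents differ by at most 1 at every d are ordered by their first
-- difference, whatever y is.  This gives 1 - 1/q ≤ F ≤ (1 - 1/q)⁻¹, which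
-- settles φ(n) - φ(m) ≥ 2; a difference of 1 forces m ≤ 2 as totients are even
-- otherwise.  If φ(m) = φ(n), products of opposite signs lie on opposite sides
-- of 1, and those of equal sign are ordered by their first difference when the
-- t agree, and otherwise by the size of their leading factors, the larger t
-- giving the value closer to 1.
--
-- That Φₙ(q) is an integer and has this product form follows from
-- Φ_{pn}(ζ, x) = Φₙ(ζ^p, x^p) if p ∣ n and
-- Φ_{pn}(ζ, x) Φₙ(ζ^p, x) = Φₙ(ζ^p, x^p) otherwise.
module Submission where

open import Defs
open import Algebra.Apartness.Bundles using (HeytingCommutativeRing; HeytingField)
open import Algebra.Bundles using (AbelianGroup; CommutativeMonoid; CommutativeRing)
import Algebra.Properties.AbelianGroup
import Algebra.Properties.CommutativeSemigroup
import Algebra.Properties.Ring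
import Algebra.Properties.Semiring.Exp
import Algebra.Properties.Semiring.Mult
import Algebra.Solver.Ring.NaturalCoefficients.Default
open import Algebra.Structures using (IsAbelianGroup)
open import Data.Bool.Base using (Bool; true; false; if_then_else_; _∧_)
open import Data.List.Base using (List; []; _∷_; applyUpTo; filter; foldr; length; map)
open import Data.List.Membership.Propositional using (_∈_; _∉_)
open import Data.List.Properties using (length-applyUpTo; length-map; map-∘)
open import Data.List.Relation.Binary.Permutation.Propositional.Properties using (↭-length)
open import Data.List.Relation.Unary.All as All using (All; []; _∷_)
import Data.List.Relation.Unary.All.Properties as All
open import Data.List.Relation.Unary.AllPairs as AllPairs using (AllPairs; []; _∷_)
import Data.List.Relation.Unary.AllPairs.Properties as AllPairs
open import Data.List.Relation.Unary.Any using (here; there)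
open import Data.Maybe.Base as Maybe using (Maybe; just; nothing; _<∣>_)
open import Data.Nat.Base as ℕ using (ℕ; zero; suc; NonZero; z≤n; s≤s; z<s; s<s)
open import Data.Nat.Coprimality as Coprimality
  using (Coprime; coprime-divisor; coprime⇒gcd≡1; gcd≡1⇒coprime)
open import Data.Nat.Divisibility
open import Data.Nat.GCD using (gcd)
open import Data.Nat.ListAction using (product)
open import Data.Nat.Primality
open import Data.Nat.Primality.Factorisation
import Data.Nat.Properties as ℕ
open import Data.Nat.Tactic.RingSolver using (solve-∀)
open import Data.Product.Base using (_×_; _,_; proj₁; proj₂; swap; ∃-syntax)
open import Data.Sign.Base as Sign using (Sign; opposite)
open import Data.Sum.Base as Sum using (_⊎_; inj₁; inj₂)
open import Data.Unit.Base using (⊤; tt)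
open import Function.Base using (_∘_)
open import Function.Bundles using (mk⇔)
open import Level using (0ℓ; _⊔_)
open import Relation.Binary.Definitions using (tri<; tri≈; tri>)
open import Relation.Binary.PropositionalEquality as ≡ using (_≡_; cong; cong₂; subst; subst₂)
import Relation.Binary.Reasoning.Setoid
open import Relation.Nullary using (¬_; Dec; does; yes; no; contradiction)
open import Relation.Nullary.Decidable using (dec-false; dec-true; does-⇔; toWitness)

-- `K` carries no order and is not given decidable equality, so only algebra happens in it: what
-- reaches the inequalities is `Quotient`, a relation between natural numbers. Integrality cannot be
-- read off the values, since the recursion at a point only exhibits the value as a ratio B / A; it
-- is proved for coefficients, by dividing polynomials over the integers.
--
-- The theorem asks for one direction valid for every q, so each comparison has to be decided by
-- data free of q. Once the sign of the whole product is split off, exponents 1 and -1 never meet at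
-- the same d: a nonzero exponent is Liouville's λ(d), whichever n it comes from. `F′` is this
-- normalised product; its exponent at d = 1 is 1, and it is at most 1.
--
-- For different t the leading factors decide only if the later ones cannot close the gap. The
-- narrowest case is q = 2 with t = 1 against t = 2, where the two bounds differ by less than
-- 0.0003; peeling off the factors up to d = 6 serves q = 2 alone.

-- Products over the residues coprime to n

module TotativeProducts where
  open import Data.Nat.Base
  open import Data.Nat.Properties

  -- Generic in the monoid for the sake of three instances: multiplication in the field gives Φ,
  -- addition on ℕ gives the totient by the same identities, and positive fractions give the product
  -- formula.
  module RangeProduct {a ℓ} (M : CommutativeMonoid a ℓ) where
    open CommutativeMonoid M
    open import Relation.Binary.Reasoning.Setoid setoid
    open import Algebra.Properties.CommutativeSemigroup commutativeSemigroup using (interchange)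

    ∏ : ℕ → (ℕ → Carrier) → Carrier
    ∏ zero    h = ε
    ∏ (suc n) h = h 0 ∙ ∏ n (λ i → h (suc i))

    ∏-cong : ∀ n {g h} → (∀ i → i < n → g i ≈ h i) → ∏ n g ≈ ∏ n h
    ∏-cong zero    eq = refl
    ∏-cong (suc n) eq = ∙-cong (eq 0 z<s) (∏-cong n λ i i<n → eq (suc i) (s<s i<n))

    ∏-cong′ : ∀ n {g h} → (∀ i → g i ≈ h i) → ∏ n g ≈ ∏ n h
    ∏-cong′ n eq = ∏-cong n λ i _ → eq i

    ∏-ε : ∀ n {h} → (∀ i → i < n → h i ≈ ε) → ∏ n h ≈ ε
    ∏-ε zero    eq = refl
    ∏-ε (suc n) eq = trans (∙-cong (eq 0 z<s) (∏-ε n λ i i<n → eq (suc i) (s<s i<n))) (identityˡ ε)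

    ∏-∙ : ∀ n g h → ∏ n (λ i → g i ∙ h i) ≈ ∏ n g ∙ ∏ n h
    ∏-∙ zero    g h = sym (identityˡ ε)
    ∏-∙ (suc n) g h = begin
      (g 0 ∙ h 0) ∙ ∏ n (λ i → g (suc i) ∙ h (suc i)) ≈⟨ ∙-congˡ (∏-∙ n _ _) ⟩
      (g 0 ∙ h 0) ∙ (∏ n (λ i → g (suc i)) ∙ ∏ n (λ i → h (suc i))) ≈⟨ interchange _ _ _ _ ⟩
      ∏ (suc n) g ∙ ∏ (suc n) h ∎

    ∏-+ : ∀ m n h → ∏ (m + n) h ≈ ∏ m h ∙ ∏ n (λ i → h (m + i))
    ∏-+ zero    n h = sym (identityˡ _)
    ∏-+ (suc m) n h = trans (∙-congˡ (∏-+ m n _)) (sym (assoc _ _ _))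

    ∏-residues : ∀ p n h → ∏ (p * n) h ≈ ∏ n (λ i → ∏ p (λ j → h (j * n + i)))
    ∏-residues zero    n h = sym (∏-ε n λ _ _ → refl)
    ∏-residues (suc p) n h = begin
      ∏ (n + p * n) h
        ≈⟨ ∏-+ n (p * n) h ⟩
      ∏ n h ∙ ∏ (p * n) (λ i → h (n + i))
        ≈⟨ ∙-congˡ (∏-residues p n _) ⟩
      ∏ n h ∙ ∏ n (λ i → ∏ p (λ j → h (n + (j * n + i))))
        ≈⟨ ∏-∙ n _ _ ⟨
      ∏ n (λ i → h i ∙ ∏ p (λ j → h (n + (j * n + i))))
        ≈⟨ ∏-cong′ n (λ i → ∙-congˡ (∏-cong′ p λ j → reflexive (cong h (≡.sym (+-assoc n (j * n) i))))) ⟩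
      ∏ n (λ i → ∏ (suc p) (λ j → h (j * n + i))) ∎

    -- A product over 1 ≤ d ≤ n p (with d = suc i) supported on the multiples of p.
    ∏-multiples : ∀ p .{{_ : NonZero p}} n h → (∀ i → ¬ p ∣ suc i → h i ≈ ε) →
                  ∏ (n * p) h ≈ ∏ n (λ j → h (pred (suc j * p)))
    ∏-multiples p         zero    h h≈ε = refl
    ∏-multiples p@(suc r) (suc n) h h≈ε = begin
      ∏ (p + n * p) h
        ≈⟨ ∏-+ p (n * p) h ⟩
      ∏ p h ∙ ∏ (n * p) (λ i → h (p + i))
        ≈⟨ ∙-cong first (∏-multiples p n _ λ i p∤ → h≈ε (p + i) λ p∣ → p∤
             (∣m+n∣m⇒∣n (subst (p ∣_) (≡.sym (+-suc p i)) p∣) ∣-refl)) ⟩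
      h r ∙ ∏ n (λ j → h (p + pred (suc j * p)))
        ≈⟨ ∙-cong (reflexive (cong h (≡.sym (+-identityʳ r))))
                  (∏-cong′ n λ j → reflexive (cong h (≡.sym (+-suc r _)))) ⟩
      ∏ (suc n) (λ j → h (pred (suc j * p))) ∎
      where
      -- The only multiple of p among 1, ..., p is p itself, at the last index r.
      first : ∏ p h ≈ h r
      first = begin
        ∏ p h                         ≡⟨ cong (λ k → ∏ k h) (+-comm 1 r) ⟩
        ∏ (r + 1) h                   ≈⟨ ∏-+ r 1 h ⟩
        ∏ r h ∙ (h (r + 0) ∙ ε)       ≈⟨ ∙-congʳ (∏-ε r λ i i<r → h≈ε i (>⇒∤ (s<s i<r))) ⟩
        ε ∙ (h (r + 0) ∙ ε)           ≈⟨ trans (identityˡ _) (identityʳ _) ⟩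
        h (r + 0)                     ≡⟨ cong h (+-identityʳ r) ⟩
        h r ∎

  coprimeᵇ : ℕ → ℕ → Bool
  coprimeᵇ a n = does (gcd a n ≟ 1)

  coprimeᵇ-cong : ∀ a m b n → (Coprime a m → Coprime b n) → (Coprime b n → Coprime a m) →
                  coprimeᵇ a m ≡ coprimeᵇ b n
  coprimeᵇ-cong a m b n to from = does-⇔
    (mk⇔ (coprime⇒gcd≡1 ∘ to ∘ gcd≡1⇒coprime) (coprime⇒gcd≡1 ∘ from ∘ gcd≡1⇒coprime))
    (gcd a m ≟ 1) (gcd b n ≟ 1)

  prime∣prime⇒≡ : ∀ {p q} → Prime p → Prime q → p ∣ q → p ≡ q
  prime∣prime⇒≡ pp pq p∣q with prime⇒irreducible pq p∣q
  ... | inj₁ ≡.refl = contradiction pp ¬prime[1]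
  ... | inj₂ p≡q = p≡q

  prime∤⇒coprime : ∀ {p n} → Prime p → ¬ p ∣ n → Coprime p n
  prime∤⇒coprime pp p∤n (d∣p , d∣n) with prime⇒irreducible pp d∣p
  ... | inj₁ d≡1    = d≡1
  ... | inj₂ ≡.refl = contradiction d∣n p∤n

  coprimeᵇ-periodic : ∀ j a n → coprimeᵇ (j * n + a) n ≡ coprimeᵇ a n
  coprimeᵇ-periodic j a n = coprimeᵇ-cong (j * n + a) n a n
    (λ c (d∣a , d∣n) → c (∣m∣n⇒∣m+n (∣n⇒∣m*n j d∣n) d∣a , d∣n))
    (λ c (d∣ , d∣n) → c (∣m+n∣m⇒∣n d∣ (∣n⇒∣m*n j d∣n) , d∣n))

  coprimeᵇ-absorb : ∀ {p n} a → p ∣ n → coprimeᵇ a (p * n) ≡ coprimeᵇ a n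
  coprimeᵇ-absorb {p} {n} a p∣n = coprimeᵇ-cong a (p * n) a n
    (λ c (d∣a , d∣n) → c (d∣a , ∣n⇒∣m*n p d∣n))
    (λ {c {d} (d∣a , d∣pn) → let d∣p = coprime-divisor (λ (e∣d , e∣n) → c (∣-trans e∣d d∣a , e∣n))
                                     (subst (d ∣_) (*-comm p n) d∣pn)
                         in c (d∣a , ∣-trans d∣p p∣n)})

  coprimeᵇ-multiple : ∀ {p n} a → Coprime p n → coprimeᵇ (a * p) n ≡ coprimeᵇ a n
  coprimeᵇ-multiple {p} {n} a p⊥n = coprimeᵇ-cong (a * p) n a n
    (λ c (d∣a , d∣n) → c (∣m⇒∣m*n p d∣a , d∣n))
    (λ {c {d} (d∣ap , d∣n) → c (coprime-divisor (λ (e∣d , e∣p) → p⊥n (e∣p , ∣-trans e∣d d∣n))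
                              (subst (d ∣_) (*-comm a p) d∣ap) , d∣n)})

  module TotativeProduct {a ℓ} (M : CommutativeMonoid a ℓ) where
    open CommutativeMonoid M
    open RangeProduct M
    open import Relation.Binary.Reasoning.Setoid setoid

    infix 8 [_]_
    [_]_ : Bool → Carrier → Carrier
    [ b ] x = if b then x else ε

    []-cong : ∀ b {x y} → x ≈ y → [ b ] x ≈ [ b ] y
    []-cong true  x≈y = x≈y
    []-cong false x≈y = refl

    []-∏ : ∀ b n h → ∏ n (λ i → [ b ] h i) ≈ [ b ] ∏ n h
    []-∏ true  n h = refl
    []-∏ false n h = ∏-ε n λ _ _ → refl

    foldr-filter : ∀ {P : ℕ → Set} (P? : ∀ i → Dec (P i)) h f n →
      foldr _∙_ ε (map h (filter P? (applyUpTo f n))) ≈ ∏ n (λ i → [ does (P? (f i)) ] h (f i))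
    foldr-filter P? h f zero = refl
    foldr-filter P? h f (suc n) with does (P? (f 0))
    ... | true  = ∙-congˡ (foldr-filter P? h (f ∘ suc) n)
    ... | false = trans (foldr-filter P? h (f ∘ suc) n) (sym (identityˡ _))

    ∏⊥ : ℕ → (ℕ → Carrier) → Carrier
    ∏⊥ n h = ∏ n (λ i → [ coprimeᵇ (suc i) n ] h (suc i))

    ∏⊥-cong : ∀ n {g h} → (∀ a → 0 < a → a ≤ n → g a ≈ h a) → ∏⊥ n g ≈ ∏⊥ n h
    ∏⊥-cong n eq = ∏-cong n λ i i<n → []-cong (coprimeᵇ (suc i) n) (eq (suc i) z<s i<n)

    private
      residues : ∀ p n (h : ℕ → Carrier) → ∏ (p * n) (λ i → [ coprimeᵇ (suc i) n ] h (suc i)) ≈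
                 ∏⊥ n (λ a → ∏ p (λ j → h (j * n + a)))
      residues p n h = begin
        ∏ (p * n) (λ i → [ coprimeᵇ (suc i) n ] h (suc i))
          ≈⟨ ∏-residues p n _ ⟩
        ∏ n (λ i → ∏ p (λ j → [ coprimeᵇ (suc (j * n + i)) n ] h (suc (j * n + i))))
          ≈⟨ ∏-cong′ n (λ i → ∏-cong′ p λ j → reflexive (pointwise i j)) ⟩
        ∏ n (λ i → ∏ p (λ j → [ coprimeᵇ (suc i) n ] h (j * n + suc i)))
          ≈⟨ ∏-cong′ n (λ i → []-∏ (coprimeᵇ (suc i) n) p _) ⟩
        ∏⊥ n (λ a → ∏ p (λ j → h (j * n + a))) ∎
        where
        pointwise : ∀ i j → [ coprimeᵇ (suc (j * n + i)) n ] h (suc (j * n + i)) ≡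
                    [ coprimeᵇ (suc i) n ] h (j * n + suc i)
        pointwise i j rewrite ≡.sym (+-suc (j * n) i) | coprimeᵇ-periodic j (suc i) n = ≡.refl

    -- When p divides n, coprimality to p n and to n agree, so the totatives of p n are those of n
    -- shifted by j n with j < p.
    ∏⊥-old : ∀ {p n} (h : ℕ → Carrier) → p ∣ n → ∏⊥ (p * n) h ≈ ∏⊥ n (λ a → ∏ p (λ j → h (j * n + a)))
    ∏⊥-old {p} {n} h p∣n = trans
      (∏-cong′ (p * n) λ i → reflexive (cong (λ b → [ b ] h (suc i)) (coprimeᵇ-absorb (suc i) p∣n)))
      (residues p n h)

    -- Among 1, ..., p n the numbers coprime to n are those coprime to p n together with the
    -- multiples a p, where a is coprime to n. The second factor on the left restores these
    -- multiples.
    ∏⊥-new : ∀ {p n} (h : ℕ → Carrier) → Prime p → ¬ p ∣ n →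
      ∏⊥ (p * n) h ∙ ∏⊥ n (λ a → h (a * p)) ≈ ∏⊥ n (λ a → ∏ p (λ j → h (j * n + a)))
    ∏⊥-new {p} {n} h pp p∤n = begin
      ∏⊥ (p * n) h ∙ ∏⊥ n (λ a → h (a * p))
        ≈⟨ ∙-congˡ multiples ⟨
      ∏⊥ (p * n) h ∙ ∏ (p * n) rest
        ≈⟨ ∏-∙ (p * n) _ _ ⟨
      ∏ (p * n) (λ i → [ coprimeᵇ (suc i) (p * n) ] h (suc i) ∙ rest i)
        ≈⟨ ∏-cong′ (p * n) split ⟩
      ∏ (p * n) (λ i → [ coprimeᵇ (suc i) n ] h (suc i))
        ≈⟨ residues p n h ⟩
      ∏⊥ n (λ a → ∏ p (λ j → h (j * n + a))) ∎
      where
      instance _ = prime⇒nonZero pp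
      p⊥n : Coprime p n
      p⊥n = prime∤⇒coprime pp p∤n
      rest : ℕ → Carrier
      rest i = [ does (p ∣? suc i) ∧ coprimeᵇ (suc i) n ] h (suc i)

      rest-multiple : ∀ j → rest (pred (suc j * p)) ≡ [ coprimeᵇ (suc j) n ] h (suc j * p)
      rest-multiple j rewrite suc-pred (suc j * p) {{m*n≢0 (suc j) p}}
                            | dec-true (p ∣? suc j * p) (n∣m*n (suc j))
                            | coprimeᵇ-multiple (suc j) p⊥n = ≡.refl

      rest-nonmultiple : ∀ i → ¬ p ∣ suc i → rest i ≈ ε
      rest-nonmultiple i p∤ rewrite dec-false (p ∣? suc i) p∤ = refl

      multiples : ∏ (p * n) rest ≈ ∏⊥ n (λ a → h (a * p))
      multiples = begin
        ∏ (p * n) rest ≡⟨ cong (λ k → ∏ k rest) (*-comm p n) ⟩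
        ∏ (n * p) rest ≈⟨ ∏-multiples p n rest rest-nonmultiple ⟩
        ∏ n (λ j → rest (pred (suc j * p))) ≈⟨ ∏-cong′ n (λ j → reflexive (rest-multiple j)) ⟩
        ∏⊥ n (λ a → h (a * p)) ∎

      split : ∀ i → [ coprimeᵇ (suc i) (p * n) ] h (suc i) ∙ rest i ≈ [ coprimeᵇ (suc i) n ] h (suc i)
      split i with p ∣? suc i
      ... | yes p∣ rewrite dec-false (gcd (suc i) (p * n) ≟ 1) (λ g → contradiction pp
                             (subst (¬_ ∘ Prime) (≡.sym (gcd≡1⇒coprime g (p∣ , m∣m*n n))) ¬prime[1]))
          = identityˡ _
      ... | no p∤ = trans (identityʳ _) (reflexive (cong (λ b → [ b ] h (suc i))
        (coprimeᵇ-cong (suc i) (p * n) (suc i) n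
          (λ c (d∣a , d∣n) → c (d∣a , ∣n⇒∣m*n p d∣n))
          (λ {c {d} (d∣a , d∣pn) → c (d∣a , coprime-divisor (Coprimality.sym (prime∤⇒coprime pp
               (p∤ ∘ λ p∣d → ∣-trans p∣d d∣a))) d∣pn)}))))

open TotativeProducts

-- Polynomials over a commutative ring: division, roots, cancellation

module Polynomials {c ℓ} (R : CommutativeRing c ℓ) where
  open CommutativeRing R
  open Algebra.Properties.Ring ring
  open Algebra.Properties.Semiring.Exp semiring using (_^_)
  open Algebra.Solver.Ring.NaturalCoefficients.Default commutativeSemiring
    using (solve; _:=_; _:+_; _:*_; con)
  open Relation.Binary.Reasoning.Setoid setoid

  -- The predicate on coefficients has two uses: `Integral` for integer coefficients, and `Whole`
  -- where only the degree matters, as in counting roots.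
  record IsSubring {s} (S : Carrier → Set s) : Set (c ⊔ ℓ ⊔ s) where
    field
      0∈ : S 0#
      +∈ : ∀ {a b} → S a → S b → S (a + b)
      *∈ : ∀ {a b} → S a → S b → S (a * b)
      -∈ : ∀ {a} → S a → S (- a)

  -- Polynomials are given as functions, with coefficients in S read off by Horner's scheme.
  data Degree< {s} (S : Carrier → Set s) : ℕ → (Carrier → Carrier) → Set (c ⊔ ℓ ⊔ s) where
    null   : ∀ {f} → (∀ x → f x ≈ 0#) → Degree< S 0 f
    horner : ∀ {n f g a} → S a → Degree< S n g → (∀ x → f x ≈ x * g x + a) → Degree< S (suc n) f

  data Monic {s} (S : Carrier → Set s) : ℕ → (Carrier → Carrier) → Set (c ⊔ ℓ ⊔ s) where
    one    : ∀ {f} → (∀ x → f x ≈ 1#) → Monic S 0 f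
    horner : ∀ {n f g a} → S a → Monic S n g → (∀ x → f x ≈ x * g x + a) → Monic S (suc n) f

  module _ {s} {S : Carrier → Set s} where

    Degree<-resp : ∀ {n f g} → (∀ x → f x ≈ g x) → Degree< S n f → Degree< S n g
    Degree<-resp f≈g (null eq)       = null λ x → trans (sym (f≈g x)) (eq x)
    Degree<-resp f≈g (horner a p eq) = horner a p λ x → trans (sym (f≈g x)) (eq x)

    Monic-resp : ∀ {n f g} → (∀ x → f x ≈ g x) → Monic S n f → Monic S n g
    Monic-resp f≈g (one eq)        = one λ x → trans (sym (f≈g x)) (eq x)
    Monic-resp f≈g (horner a p eq) = horner a p λ x → trans (sym (f≈g x)) (eq x)

    Monic-cong : ∀ {n f} → Monic S n f → ∀ {x y} → x ≈ y → f x ≈ f y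
    Monic-cong (one eq)        x≈y = trans (eq _) (sym (eq _))
    Monic-cong (horner a p eq) x≈y =
      trans (eq _) (trans (+-congʳ (*-cong x≈y (Monic-cong p x≈y))) (sym (eq _)))

    module _ {t} {T : Carrier → Set t} (S⊆T : ∀ {a} → S a → T a) where

      Degree<-weaken : ∀ {n f} → Degree< S n f → Degree< T n f
      Degree<-weaken (null eq)       = null eq
      Degree<-weaken (horner a p eq) = horner (S⊆T a) (Degree<-weaken p) eq

      Monic-weaken : ∀ {n f} → Monic S n f → Monic T n f
      Monic-weaken (one eq)        = one eq
      Monic-weaken (horner a p eq) = horner (S⊆T a) (Monic-weaken p) eq

  module Closure {s} {S : Carrier → Set s} (isSubring : IsSubring S) where
    open IsSubring isSubring

    Monic-sub : ∀ {n f g} → Monic S n f → Monic S n g → Degree< S n (λ x → f x - g x)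
    Monic-sub (one eq) (one eq′) = null λ x → trans (+-cong (eq x) (-‿cong (eq′ x))) (-‿inverseʳ 1#)
    Monic-sub (horner {g = g} {a} a∈ p eq) (horner {g = h} {b} b∈ q eq′) =
      horner (+∈ a∈ (-∈ b∈)) (Monic-sub p q) λ x → begin
        _ ≈⟨ +-cong (eq x) (-‿cong (eq′ x)) ⟩
        (x * g x + a) - (x * h x + b)
          ≈⟨ +-congˡ (trans (sym (-‿+-comm _ _)) (+-congʳ (-‿distribʳ-* x _))) ⟩
        (x * g x + a) + (x * (- h x) + - b)
          ≈⟨ solve 5 (λ x g h a b → (x :* g :+ a) :+ (x :* h :+ b) := x :* (g :+ h) :+ (a :+ b))
               refl x (g x) (- h x) a (- b) ⟩
        x * (g x - h x) + (a - b) ∎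

    Monic-+const : ∀ {n f a} → S a → Monic S (suc n) f → Monic S (suc n) (λ x → f x + a)
    Monic-+const a (horner b p eq) = horner (+∈ b a) p λ x → trans (+-congʳ (eq x)) (+-assoc _ _ _)

    Degree<-+const : ∀ {n f a} → S a → Degree< S (suc n) f → Degree< S (suc n) (λ x → f x + a)
    Degree<-+const a (horner b p eq) = horner (+∈ b a) p λ x → trans (+-congʳ (eq x)) (+-assoc _ _ _)

    Monic-*linear : ∀ {n f t} → S t → Monic S n f → Monic S (suc n) (λ x → (x + t) * f x)
    Monic-*linear {t = t} t∈ (one eq) = horner t∈ (one {f = λ _ → 1#} λ _ → refl) λ x →
      trans (*-congˡ (eq x)) (trans (*-identityʳ _) (+-congʳ (sym (*-identityʳ x))))
    Monic-*linear {t = t} t∈ (horner a∈ p eq) =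
      horner (*∈ t∈ a∈) (Monic-+const a∈ (Monic-*linear t∈ p)) λ x → trans (*-congˡ (eq x))
        (solve 4 (λ x t g a → (x :+ t) :* (x :* g :+ a) := x :* ((x :+ t) :* g :+ a) :+ t :* a)
          refl x t _ _)

    Degree<-*linear : ∀ {n f t} → S t → Degree< S n f → Degree< S (suc n) (λ x → (x + t) * f x)
    Degree<-*linear t∈ (null eq) = horner 0∈ (null {f = λ _ → 0#} λ _ → refl) λ x →
      trans (trans (*-congˡ (eq x)) (zeroʳ _)) (sym (trans (+-identityʳ _) (zeroʳ x)))
    Degree<-*linear {t = t} t∈ (horner a∈ p eq) =
      horner (*∈ t∈ a∈) (Degree<-+const a∈ (Degree<-*linear t∈ p)) λ x → trans (*-congˡ (eq x))
        (solve 4 (λ x t g a → (x :+ t) :* (x :* g :+ a) := x :* ((x :+ t) :* g :+ a) :+ t :* a)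
          refl x t _ _)

    Monic-^* : ∀ k {n f} → Monic S n f → Monic S (k ℕ.+ n) (λ x → x ^ k * f x)
    Monic-^* zero    p = Monic-resp (λ x → sym (*-identityˡ _)) p
    Monic-^* (suc k) p = horner 0∈ (Monic-^* k p) λ x →
      trans (*-assoc x _ _) (sym (+-identityʳ _))

    Monic-∘^ : ∀ {n f} k → Monic S n f → Monic S (n ℕ.* suc k) (λ x → f (x ^ suc k))
    Monic-∘^ k (one eq) = one λ x → eq _
    Monic-∘^ k (horner a p eq) =
      Monic-resp (λ x → sym (eq _)) (Monic-+const a (Monic-^* (suc k) (Monic-∘^ k p)))

    Monic-^+const : ∀ k {a} → S a → Monic S (suc k ℕ.+ 0) (λ x → x ^ suc k * 1# + a)
    Monic-^+const k a = Monic-+const a (Monic-^* (suc k) (one {f = λ _ → 1#} λ _ → refl))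

    -- One step of long division. The factor `t` is the coefficient of x^n in f; as g is monic, no
    -- division of coefficients occurs.
    reduce : ∀ {n f g} → Monic S n g → Degree< S (suc n) f →
             ∃[ t ] ∃[ r ] S t × Degree< S n r × (∀ x → f x ≈ t * g x + r x)
    reduce (one eq) (horner {a = a} a∈ (null eq₀) eq′) =
      a , (λ _ → 0#) , a∈ , null (λ _ → refl) , λ x → begin
        _              ≈⟨ eq′ x ⟩
        x * _ + a      ≈⟨ +-congʳ (trans (*-congˡ (eq₀ x)) (zeroʳ x)) ⟩
        0# + a         ≈⟨ +-comm _ _ ⟩
        a + 0#         ≈⟨ +-congʳ (trans (*-congˡ (eq x)) (*-identityʳ a)) ⟨
        a * _ + 0#     ∎
    reduce (horner {g = g} {b} b∈ p eq) (horner {a = a} a∈ q eq′)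
      with t , r , t∈ , r-deg , f≈ ← reduce p q =
      t , (λ x → x * r x + (a + - (t * b))) , t∈ ,
      horner (+∈ a∈ (-∈ (*∈ t∈ b∈))) r-deg (λ _ → refl) , λ x → begin
        _ ≈⟨ eq′ x ⟩
        x * _ + a ≈⟨ +-congʳ (*-congˡ (f≈ x)) ⟩
        x * (t * g x + r x) + a
          ≈⟨ trans (sym (+-identityʳ _)) (+-congˡ (sym (-‿inverseʳ (t * b)))) ⟩
        x * (t * g x + r x) + a + (t * b - t * b)
          ≈⟨ solve 7 (λ x t g r a b u → x :* (t :* g :+ r) :+ a :+ (t :* b :+ u) :=
                                       t :* (x :* g :+ b) :+ (x :* r :+ (a :+ u)))
               refl x t (g x) (r x) a b (- (t * b)) ⟩
        t * (x * g x + b) + (x * r x + (a - t * b)) ≈⟨ +-congʳ (*-congˡ (eq x)) ⟨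
        t * _ + (x * r x + (a - t * b)) ∎

    -- Horner's form makes long division structural: for f = x f′ + a, divide f′ first, then reduce
    -- x r + a, where r is the remainder of f′.
    divide : ∀ k {n f g} → Monic S n g → Monic S (k ℕ.+ n) f →
             ∃[ h ] ∃[ r ] Monic S k h × Degree< S n r × (∀ x → f x ≈ g x * h x + r x)
    divide zero {f = f} {g} g-monic f-monic =
      (λ _ → 1#) , (λ x → f x - g x) , one (λ _ → refl) , Monic-sub f-monic g-monic , λ x → begin
        f x                     ≈⟨ +-identityʳ _ ⟨
        f x + 0#                ≈⟨ +-congˡ (-‿inverseʳ (g x)) ⟨
        f x + (g x - g x)       ≈⟨ solve 3 (λ f g u → f :+ (g :+ u) := g :* con 1 :+ (f :+ u))
                                     refl (f x) (g x) (- g x) ⟩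
        g x * 1# + (f x - g x)  ∎
    divide (suc k) {g = g} g-monic (horner {a = a} a∈ p eq)
      with h , r , h-monic , r-deg , f≈ ← divide k g-monic p
      with t , r′ , t∈ , r′-deg , r≈ ← reduce g-monic (horner {a = a} a∈ r-deg (λ _ → refl)) =
      (λ x → x * h x + t) , r′ , horner t∈ h-monic (λ _ → refl) , r′-deg , λ x → begin
        _                               ≈⟨ eq x ⟩
        x * _ + a                       ≈⟨ +-congʳ (*-congˡ (f≈ x)) ⟩
        x * (g x * h x + r x) + a       ≈⟨ solve 5 (λ x g h r a → x :* (g :* h :+ r) :+ a :=
                                             g :* (x :* h) :+ (x :* r :+ a)) refl x (g x) (h x) (r x) a ⟩
        g x * (x * h x) + (x * r x + a) ≈⟨ +-congˡ (r≈ x) ⟩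
        g x * (x * h x) + (t * g x + r′ x) ≈⟨ solve 5 (λ g x h t r → g :* (x :* h) :+ (t :* g :+ r) :=
                                             g :* (x :* h :+ t) :+ r) refl (g x) x (h x) t (r′ x) ⟩
        g x * (x * h x + t) + r′ x      ∎

  Whole : Carrier → Set
  Whole _ = ⊤

  wholeSubring : IsSubring Whole
  wholeSubring = record { 0∈ = tt ; +∈ = λ _ _ → tt ; *∈ = λ _ _ → tt ; -∈ = λ _ → tt }

  open Closure wholeSubring using (Monic-*linear; Degree<-*linear)

  -‿≉0 : ∀ {x y} → ¬ x ≈ y → ¬ x - y ≈ 0#
  -‿≉0 {x} {y} x≉y = x≉y ∘ x∙y⁻¹≈ε⇒x≈y x y

  factor : ∀ {n f} → Degree< Whole (suc n) f → ∀ r →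
           ∃[ h ] Degree< Whole n h × (∀ x → f x ≈ (x - r) * h x + f r)
  factor {zero} {f} (horner {a = a} tt (null eq₀) eq) r =
    (λ _ → 0#) , null (λ _ → refl) , λ x →
      trans (constant x) (sym (trans (+-cong (zeroʳ _) (constant r)) (+-identityˡ a)))
    where
    constant : ∀ x → f x ≈ a
    constant x = trans (eq x) (trans (+-congʳ (trans (*-congˡ (eq₀ x)) (zeroʳ x))) (+-identityˡ a))
  factor {suc n} {f} (horner {g = g} {a} tt p eq) r with h , h-deg , g≈ ← factor p r =
    (λ x → x * h x + g r) , horner tt h-deg (λ _ → refl) , λ x → begin
      f x ≈⟨ eq x ⟩
      x * g x + a ≈⟨ +-congʳ (*-congˡ (g≈ x)) ⟩
      x * ((x - r) * h x + g r) + a ≈⟨ +-identityʳ _ ⟨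
      x * ((x - r) * h x + g r) + a + 0#
        ≈⟨ +-congˡ (trans (*-congʳ (-‿inverseʳ r)) (zeroˡ (g r))) ⟨
      x * ((x - r) * h x + g r) + a + (r - r) * g r
        ≈⟨ solve 6 (λ x r s h G a → x :* ((x :+ s) :* h :+ G) :+ a :+ (r :+ s) :* G :=
                     (x :+ s) :* (x :* h :+ G) :+ (r :* G :+ a)) refl x r (- r) (h x) (g r) a ⟩
      (x - r) * (x * h x + g r) + (r * g r + a) ≈⟨ +-congˡ (eq r) ⟨
      (x - r) * (x * h x + g r) + f r ∎

  ∏linear : List Carrier → Carrier → Carrier
  ∏linear rs x = foldr _*_ 1# (map (λ r → x - r) rs)

  ∏linear-monic : ∀ rs → Monic Whole (length rs) (∏linear rs)
  ∏linear-monic []       = one λ _ → refl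
  ∏linear-monic (r ∷ rs) = Monic-*linear tt (∏linear-monic rs)

  module IntegralDomain (*-zero : ∀ {x y} → x * y ≈ 0# → ¬ x ≈ 0# → y ≈ 0#) where

    vanish : ∀ {f} rs → AllPairs (λ r s → ¬ r ≈ s) rs → All (λ r → f r ≈ 0#) rs →
             Degree< Whole (length rs) f → ∀ x → f x ≈ 0#
    vanish [] [] [] (null eq) = eq
    vanish {f} (r ∷ rs) (r≉ ∷ distinct) (fr≈0 ∷ roots) p x
      with h , h-deg , f≈ ← factor p r = trans (f≈′ x) (trans (*-congˡ
        (vanish rs distinct (All.zipWith root (r≉ , roots)) h-deg x)) (zeroʳ _))
      where
      f≈′ : ∀ x → f x ≈ (x - r) * h x
      f≈′ x = trans (f≈ x) (trans (+-congˡ fr≈0) (+-identityʳ _))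
      root : ∀ {s} → (¬ r ≈ s) × f s ≈ 0# → h s ≈ 0#
      root (r≉s , fs≈0) = *-zero (trans (sym (f≈′ _)) fs≈0) (-‿≉0 (r≉s ∘ sym))

    ∏linear-roots : ∀ rs → All (λ r → ∏linear rs r ≈ 0#) rs
    ∏linear-roots []       = []
    ∏linear-roots (r ∷ rs) =
      trans (*-congʳ (-‿inverseʳ r)) (zeroˡ _) ∷
      All.map (λ eq → trans (*-congˡ eq) (zeroʳ _)) (∏linear-roots rs)

    -- The difference of two monic polynomials of degree d has degree below d, yet vanishes at d
    -- distinct points.
    Monic-∏linear : ∀ {f} rs → AllPairs (λ r s → ¬ r ≈ s) rs → All (λ r → f r ≈ 0#) rs →
                    Monic Whole (length rs) f → ∀ x → f x ≈ ∏linear rs x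
    Monic-∏linear {f} rs distinct roots f-monic x = x∙y⁻¹≈ε⇒x≈y _ _
      (vanish rs distinct (All.zipWith difference (roots , ∏linear-roots rs))
        (Closure.Monic-sub wholeSubring f-monic (∏linear-monic rs)) x)
      where
      difference : ∀ {r} → f r ≈ 0# × ∏linear rs r ≈ 0# → f r - ∏linear rs r ≈ 0#
      difference (fr≈0 , ∏≈0) = trans (+-cong fr≈0 (-‿cong ∏≈0)) (-‿inverseʳ 0#)

    module _ (infinite : ∀ r M → ∃[ rs ] length rs ≡ M × AllPairs (λ s t → ¬ s ≈ t) rs ×
                                 All (λ s → ¬ r ≈ s) rs) where

      -- Pointwise cancellation says nothing at x = r, and there is no test for x = r. Instead f
      -- vanishes at M points other than r, which is enough for a polynomial of degree below M.
      cancel-linear : ∀ {M f} r → Degree< Whole M f → (∀ x → (x - r) * f x ≈ 0#) → ∀ x → f x ≈ 0#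
      cancel-linear {M} r f-deg eq with rs , ≡.refl , distinct , r≉ ← infinite r M =
        vanish rs distinct (All.map (λ r≉s → *-zero (eq _) (-‿≉0 (r≉s ∘ sym))) r≉) f-deg

      cancel-∏linear : ∀ {M f} rs → Degree< Whole M f → (∀ x → ∏linear rs x * f x ≈ 0#) →
                       ∀ x → f x ≈ 0#
      cancel-∏linear [] f-deg eq x = trans (sym (*-identityˡ _)) (eq x)
      cancel-∏linear {M} {f} (r ∷ rs) f-deg eq =
        cancel-∏linear rs f-deg (cancel-linear r (degree rs) λ x → trans (sym (*-assoc _ _ _)) (eq x))
        where
        degree : ∀ ss → Degree< Whole (length ss ℕ.+ M) (λ x → ∏linear ss x * f x)
        degree []       = Degree<-resp (λ x → sym (*-identityˡ _)) f-deg
        degree (s ∷ ss) = Degree<-resp (λ x → sym (*-assoc _ _ _)) (Degree<-*linear tt (degree ss))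

-- Decomposition of n, and the recursion for values

-- Shape n t ps means n = t ∏ ps, where ps lists the distinct primes dividing n.
data Shape : ℕ → ℕ → List ℕ → Set where
  unit : Shape 1 1 []
  old  : ∀ {p n t ps} → Prime p → p ∈ ps → Shape n t ps → Shape (p ℕ.* n) (p ℕ.* t) ps
  new  : ∀ {p n t ps} → Prime p → p ∉ ps → Shape n t ps → Shape (p ℕ.* n) t (p ∷ ps)

shape-∈⇒∣ : ∀ {n t ps q} → Shape n t ps → q ∈ ps → q ∣ n
shape-∈⇒∣ (old {p} _ _ s) q∈           = ∣n⇒∣m*n p (shape-∈⇒∣ s q∈)
shape-∈⇒∣ (new {p} {n} _ _ s) (here ≡.refl) = m∣m*n n
shape-∈⇒∣ (new {p} _ _ s) (there q∈)   = ∣n⇒∣m*n p (shape-∈⇒∣ s q∈)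

shape-∣⇒∈ : ∀ {n t ps q} → Prime q → Shape n t ps → q ∣ n → q ∈ ps
shape-∣⇒∈ pq unit q∣ = contradiction (subst Prime (∣1⇒≡1 q∣) pq) ¬prime[1]
shape-∣⇒∈ pq (old {p} {n} pp p∈ s) q∣ with euclidsLemma p n pq q∣
... | inj₁ q∣p rewrite prime∣prime⇒≡ pq pp q∣p = p∈
... | inj₂ q∣n = shape-∣⇒∈ pq s q∣n
shape-∣⇒∈ pq (new {p} {n} pp p∉ s) q∣ with euclidsLemma p n pq q∣
... | inj₁ q∣p = here (prime∣prime⇒≡ pq pp q∣p)
... | inj₂ q∣n = there (shape-∣⇒∈ pq s q∣n)

2≤^ : ∀ {p q} → Prime p → 2 ℕ.≤ q → 2 ℕ.≤ q ℕ.^ p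
2≤^ {p} {q} pp 2≤q = ℕ.≤-trans 2≤q (ℕ.≤-trans (ℕ.≤-reflexive (≡.sym (ℕ.*-identityʳ q)))
  (ℕ.^-monoʳ-≤ q {{ℕ.>-nonZero (ℕ.<-≤-trans z<s 2≤q)}} (ℕ.>-nonZero⁻¹ p {{prime⇒nonZero pp}})))

^-comm : ∀ q a b → (q ℕ.^ a) ℕ.^ b ≡ (q ℕ.^ b) ℕ.^ a
^-comm q a b = ≡.trans (ℕ.^-*-assoc q a b)
  (≡.trans (cong (q ℕ.^_) (ℕ.*-comm a b)) (≡.sym (ℕ.^-*-assoc q b a)))

-- Quotient ps y V means V = Φ_{∏ ps}(y), in terms of Φ_{pk}(y) = Φ_k(y^p) / Φ_k(y).
data Quotient : List ℕ → ℕ → ℕ → Set where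
  base : ∀ {y V} → suc V ≡ y → Quotient [] y V
  step : ∀ {p ps y A B V} → Quotient ps y A → Quotient ps (y ℕ.^ p) B → V ℕ.* A ≡ B → Quotient (p ∷ ps) y V

module _ {a ℓ} (M : CommutativeMonoid a ℓ) where
  open CommutativeMonoid M
  open RangeProduct M

  foldr-applyUpTo : ∀ f n → foldr _∙_ ε (applyUpTo f n) ≡ ∏ n f
  foldr-applyUpTo f zero    = ≡.refl
  foldr-applyUpTo f (suc n) = cong (f 0 ∙_) (foldr-applyUpTo (f ∘ suc) n)

-- Cyclotomic polynomials over the field

module Roots {c ℓ₁ ℓ₂} (K : HeytingField c ℓ₁ ℓ₂) (char0 : Cyclotomic.CharacteristicZero K) where

  open HeytingField K using (tight; #⇒invertible; heytingCommutativeRing)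
  open HeytingCommutativeRing heytingCommutativeRing using (commutativeRing)
  open CommutativeRing commutativeRing
  open Algebra.Properties.Ring ring
  open Algebra.Properties.Semiring.Exp semiring
  open Algebra.Properties.Semiring.Mult semiring using (×-homo-+; ×1-homo-*)
    renaming (_×_ to _·_)
  open Algebra.Solver.Ring.NaturalCoefficients.Default commutativeSemiring
    using (solve; _:=_; _:+_; _:*_)
  open Relation.Binary.Reasoning.Setoid setoid
  open Cyclotomic K
  open Polynomials commutativeRing
  open RangeProduct *-commutativeMonoid
  open TotativeProduct *-commutativeMonoid
  private module Count where
    open RangeProduct ℕ.+-0-commutativeMonoid public
    open TotativeProduct ℕ.+-0-commutativeMonoid public

  -- By tightness of apartness: y apart from 0 would be invertible and force x to vanish, so y is
  -- not apart from 0, hence equals it.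
  *-zero : ∀ {x y} → x * y ≈ 0# → ¬ x ≈ 0# → y ≈ 0#
  *-zero {x} {y} xy≈0 x≉0 = proj₁ (tight y 0#) λ y#0 →
    let z , _ , y-0*z≈1 = #⇒invertible y#0 in x≉0 (begin
      x                  ≈⟨ *-identityʳ x ⟨
      x * 1#             ≈⟨ *-congˡ y-0*z≈1 ⟨
      x * ((y - 0#) * z) ≈⟨ *-congˡ (*-congʳ (trans (+-congˡ -0#≈0#) (+-identityʳ y))) ⟩
      x * (y * z)        ≈⟨ *-assoc x y z ⟨
      x * y * z          ≈⟨ *-congʳ xy≈0 ⟩
      0# * z             ≈⟨ zeroˡ z ⟩
      0#                 ∎)

  ·1-<-≉ : ∀ {m n} → m ℕ.< n → ¬ m · 1# ≈ n · 1#
  ·1-<-≉ {m} {n} m<n eq = char0 (n ℕ.∸ suc m) (+-cancelˡ (m · 1#) _ _ (begin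
    m · 1# + suc (n ℕ.∸ suc m) · 1# ≈⟨ ×-homo-+ 1# m (suc (n ℕ.∸ suc m)) ⟨
    (m ℕ.+ suc (n ℕ.∸ suc m)) · 1#  ≡⟨ cong (_· 1#) (≡.trans (ℕ.+-suc m _) (ℕ.m+[n∸m]≡n m<n)) ⟩
    n · 1#                          ≈⟨ eq ⟨
    m · 1#                          ≈⟨ +-identityʳ _ ⟨
    m · 1# + 0#                     ∎))

  ·1-injective : ∀ {m n} → m · 1# ≈ n · 1# → m ≡ n
  ·1-injective {m} {n} eq with ℕ.<-cmp m n
  ... | tri< m<n _ _ = contradiction eq (·1-<-≉ m<n)
  ... | tri≈ _ m≡n _ = m≡n
  ... | tri> _ _ n<m = contradiction (sym eq) (·1-<-≉ n<m)

  ·1-^ : ∀ m n → (m · 1#) ^ n ≈ (m ℕ.^ n) · 1#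
  ·1-^ m zero    = sym (+-identityʳ 1#)
  ·1-^ m (suc n) = trans (*-congˡ (·1-^ m n)) (sym (×1-homo-* m (m ℕ.^ n)))

  open IntegralDomain *-zero

  infinite : ∀ r M → ∃[ rs ] length rs ≡ M × AllPairs (λ s t → ¬ s ≈ t) rs × All (λ s → ¬ r ≈ s) rs
  infinite r M = applyUpTo (λ j → r + suc j · 1#) M , length-applyUpTo _ M ,
    AllPairs.applyUpTo⁺₁ _ M (λ i<j _ → ·1-<-≉ (s≤s i<j) ∘ +-cancelˡ r _ _) ,
    All.applyUpTo⁺₁ _ M (λ {j} _ r≈ → char0 j (sym (+-cancelˡ r _ _ (trans (+-identityʳ r) r≈))))

  Integral : Carrier → Set ℓ₁
  Integral x = ∃[ a ] ∃[ b ] x ≈ a · 1# - b · 1#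

  integralSubring : IsSubring Integral
  integralSubring = record
    { 0∈ = 0 , 0 , sym (-‿inverseʳ 0#)
    ; +∈ = λ {x} {y} (a , b , x≈) (a′ , b′ , y≈) → a ℕ.+ a′ , b ℕ.+ b′ , (begin
        x + y ≈⟨ +-cong x≈ y≈ ⟩
        (a · 1# - b · 1#) + (a′ · 1# - b′ · 1#)
          ≈⟨ interchange _ _ _ _ ⟩
        (a · 1# + a′ · 1#) + (- (b · 1#) + - (b′ · 1#))
          ≈⟨ +-cong (sym (×-homo-+ 1# a a′)) (trans (-‿+-comm _ _) (-‿cong (sym (×-homo-+ 1# b b′)))) ⟩
        (a ℕ.+ a′) · 1# - (b ℕ.+ b′) · 1# ∎)
    ; *∈ = λ {x} {y} (a , b , x≈) (a′ , b′ , y≈) →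
        a ℕ.* a′ ℕ.+ b ℕ.* b′ , a ℕ.* b′ ℕ.+ b ℕ.* a′ , (begin
        x * y ≈⟨ *-cong x≈ y≈ ⟩
        (a · 1# - b · 1#) * (a′ · 1# - b′ · 1#)
          ≈⟨ solve 4 (λ a b a′ b′ → (a :+ b) :* (a′ :+ b′) :=
                        (a :* a′ :+ b :* b′) :+ (a :* b′ :+ b :* a′)) refl _ _ _ _ ⟩
        (a · 1# * a′ · 1# + - (b · 1#) * - (b′ · 1#)) + (a · 1# * - (b′ · 1#) + - (b · 1#) * a′ · 1#)
          ≈⟨ +-cong (+-cong (sym (×1-homo-* a a′)) (trans ([-x][-y]≈xy _ _) (sym (×1-homo-* b b′))))
              (+-cong (trans (sym (-‿distribʳ-* _ _)) (-‿cong (sym (×1-homo-* a b′))))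
                      (trans (sym (-‿distribˡ-* _ _)) (-‿cong (sym (×1-homo-* b a′))))) ⟩
        ((a ℕ.* a′) · 1# + (b ℕ.* b′) · 1#) + (- ((a ℕ.* b′) · 1#) + - ((b ℕ.* a′) · 1#))
          ≈⟨ +-cong (sym (×-homo-+ 1# (a ℕ.* a′) _))
              (trans (-‿+-comm _ _) (-‿cong (sym (×-homo-+ 1# (a ℕ.* b′) _)))) ⟩
        (a ℕ.* a′ ℕ.+ b ℕ.* b′) · 1# - (a ℕ.* b′ ℕ.+ b ℕ.* a′) · 1# ∎)
    ; -∈ = λ {x} (a , b , x≈) → b , a , trans (-‿cong x≈) (⁻¹-anti-homo‿- _ _)
    }
    where
    open Algebra.Properties.CommutativeSemigroup +-commutativeSemigroup using (interchange)
    [-x][-y]≈xy : ∀ x y → - x * - y ≈ x * y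
    [-x][-y]≈xy x y = trans (sym (-‿distribˡ-* x (- y)))
      (trans (-‿cong (sym (-‿distribʳ-* x y))) (-‿involutive (x * y)))

  -- Roots of unity

  -- Multiplying by ζ^(n - b), rather than dividing by ζ^a, gives ζ^(a + n - b) = 1 with an exponent
  -- strictly between 0 and n.
  powers-distinct : ∀ {n ζ a b} → IsPrimitiveRoot n ζ → 0 ℕ.< a → a ℕ.< b → b ℕ.≤ n → ¬ ζ ^ a ≈ ζ ^ b
  powers-distinct {n} {ζ} {a} {b} prim 0<a a<b b≤n eq =
    ζᵏ≉1 (a ℕ.+ (n ℕ.∸ b)) (ℕ.<-≤-trans 0<a (ℕ.m≤m+n a _))
      (ℕ.<-≤-trans (ℕ.+-monoˡ-< (n ℕ.∸ b) a<b) (ℕ.≤-reflexive (ℕ.m+[n∸m]≡n b≤n)))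
      (begin
        ζ ^ (a ℕ.+ (n ℕ.∸ b))  ≈⟨ ^-homo-* ζ a _ ⟩
        ζ ^ a * ζ ^ (n ℕ.∸ b)  ≈⟨ *-congʳ eq ⟩
        ζ ^ b * ζ ^ (n ℕ.∸ b)  ≈⟨ ^-homo-* ζ b _ ⟨
        ζ ^ (b ℕ.+ (n ℕ.∸ b))  ≡⟨ cong (ζ ^_) (ℕ.m+[n∸m]≡n b≤n) ⟩
        ζ ^ n                  ≈⟨ ζⁿ≈1 ⟩
        1#                     ∎)
    where open IsPrimitiveRoot prim

  primitive-power : ∀ {p n ζ} .{{_ : NonZero p}} → IsPrimitiveRoot (p ℕ.* n) ζ → IsPrimitiveRoot n (ζ ^ p)
  primitive-power {p} {n} {ζ} prim = record
    { ζⁿ≈1 = trans (^-assocʳ ζ p n) ζⁿ≈1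
    ; ζᵏ≉1 = λ k 0<k k<n eq → ζᵏ≉1 (p ℕ.* k)
        (subst (ℕ._< p ℕ.* k) (ℕ.*-zeroʳ p) (ℕ.*-monoʳ-< p 0<k)) (ℕ.*-monoʳ-< p k<n)
        (trans (sym (^-assocʳ ζ p k)) eq)
    }
    where open IsPrimitiveRoot prim

  -- The p-th roots of (ζ^p)^a are the ζ^(jn+a) with j < p.
  x^p-ζ^pa : ∀ {p n ζ a} .{{_ : NonZero p}} → IsPrimitiveRoot (p ℕ.* n) ζ → 0 ℕ.< a → a ℕ.≤ n →
             ∀ x → x ^ p - (ζ ^ p) ^ a ≈ ∏ p (λ j → x - ζ ^ (j ℕ.* n ℕ.+ a))
  x^p-ζ^pa {p@(suc k)} {n} {ζ} {a} prim 0<a a≤n x = begin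
    x ^ p - (ζ ^ p) ^ a
      ≈⟨ +-congʳ (*-identityʳ _) ⟨
    x ^ p * 1# - (ζ ^ p) ^ a
      ≈⟨ Monic-∏linear rs distinct roots
           (subst (λ d → Monic Whole d f) (≡.trans (ℕ.+-identityʳ p) (≡.sym (length-applyUpTo root p)))
             (Closure.Monic-^+const wholeSubring k {a = - (ζ ^ p) ^ a} tt)) x ⟩
    ∏linear rs x
      ≡⟨ cong (foldr _*_ 1#) (map-applyUpTo′ (λ r → x - r) root p) ⟩
    foldr _*_ 1# (applyUpTo (λ j → x - root j) p)
      ≡⟨ foldr-applyUpTo *-commutativeMonoid (λ j → x - root j) p ⟩
    ∏ p (λ j → x - root j) ∎
    where
    open IsPrimitiveRoot prim
    root : ℕ → Carrier
    root j = ζ ^ (j ℕ.* n ℕ.+ a)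
    rs = applyUpTo root p
    f : Carrier → Carrier
    f y = y ^ p * 1# - (ζ ^ p) ^ a
    map-applyUpTo′ : ∀ (g : Carrier → Carrier) f m → map g (applyUpTo f m) ≡ applyUpTo (g ∘ f) m
    map-applyUpTo′ g f zero    = ≡.refl
    map-applyUpTo′ g f (suc m) = cong (g (f 0) ∷_) (map-applyUpTo′ g (f ∘ suc) m)
    bound : ∀ {i j} → i ℕ.< j → i ℕ.* n ℕ.+ n ℕ.≤ j ℕ.* n
    bound {i} i<j = ℕ.≤-trans (ℕ.≤-reflexive (ℕ.+-comm (i ℕ.* n) n)) (ℕ.*-monoˡ-≤ n i<j)
    distinct : AllPairs (λ r s → ¬ r ≈ s) rs
    distinct = AllPairs.applyUpTo⁺₁ root p λ {i} {j} i<j j<p → powers-distinct prim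
      (ℕ.<-≤-trans 0<a (ℕ.m≤n+m a _))
      (ℕ.≤-<-trans (ℕ.≤-trans (ℕ.+-monoʳ-≤ (i ℕ.* n) a≤n) (bound i<j)) (ℕ.m<m+n (j ℕ.* n) 0<a))
      (ℕ.≤-trans (ℕ.+-monoʳ-≤ (j ℕ.* n) a≤n) (bound j<p))
    roots : All (λ r → r ^ p * 1# - (ζ ^ p) ^ a ≈ 0#) rs
    roots = All.applyUpTo⁺₁ root p λ {j} _ → trans (+-congʳ (begin
      (ζ ^ (j ℕ.* n ℕ.+ a)) ^ p * 1#      ≈⟨ *-identityʳ _ ⟩
      (ζ ^ (j ℕ.* n ℕ.+ a)) ^ p           ≈⟨ ^-assocʳ ζ (j ℕ.* n ℕ.+ a) p ⟩
      ζ ^ ((j ℕ.* n ℕ.+ a) ℕ.* p)         ≡⟨ cong (ζ ^_) (exponent j n a p) ⟩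
      ζ ^ (p ℕ.* n ℕ.* j ℕ.+ p ℕ.* a)     ≈⟨ ^-homo-* ζ (p ℕ.* n ℕ.* j) _ ⟩
      ζ ^ (p ℕ.* n ℕ.* j) * ζ ^ (p ℕ.* a) ≈⟨ *-cong (^-assocʳ ζ (p ℕ.* n) j) (^-assocʳ ζ p a) ⟨
      (ζ ^ (p ℕ.* n)) ^ j * (ζ ^ p) ^ a   ≈⟨ *-congʳ (trans (^-congˡ j ζⁿ≈1) (1^ j)) ⟩
      1# * (ζ ^ p) ^ a                    ≈⟨ *-identityˡ _ ⟩
      (ζ ^ p) ^ a                         ∎)) (-‿inverseʳ _)
      where
      exponent : ∀ j n a p → (j ℕ.* n ℕ.+ a) ℕ.* p ≡ p ℕ.* n ℕ.* j ℕ.+ p ℕ.* a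
      exponent = solve-∀
      1^ : ∀ m → 1# ^ m ≈ 1#
      1^ zero    = refl
      1^ (suc m) = trans (*-identityˡ _) (1^ m)

  -- Recursion over the prime factors

  Φ≈∏⊥ : ∀ n ζ x → Φ n ζ x ≈ ∏⊥ n (λ a → x - ζ ^ a)
  Φ≈∏⊥ n ζ x = foldr-filter (λ a → gcd a n ℕ.≟ 1) (λ a → x - ζ ^ a) suc n

  module _ {p n ζ} (p-prime : Prime p) (prim : IsPrimitiveRoot (p ℕ.* n) ζ) where
    private instance _ = prime⇒nonZero p-prime

    Φ-residues : ∀ x → Φ n (ζ ^ p) (x ^ p) ≈ ∏⊥ n (λ a → ∏ p (λ j → x - ζ ^ (j ℕ.* n ℕ.+ a)))
    Φ-residues x = trans (Φ≈∏⊥ n (ζ ^ p) (x ^ p))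
      (∏⊥-cong n λ a 0<a a≤n → x^p-ζ^pa prim 0<a a≤n x)

    Φ-old : p ∣ n → ∀ x → Φ (p ℕ.* n) ζ x ≈ Φ n (ζ ^ p) (x ^ p)
    Φ-old p∣n x = trans (Φ≈∏⊥ (p ℕ.* n) ζ x) (trans (∏⊥-old (λ a → x - ζ ^ a) p∣n) (sym (Φ-residues x)))

    Φ-new : ¬ p ∣ n → ∀ x → Φ (p ℕ.* n) ζ x * Φ n (ζ ^ p) x ≈ Φ n (ζ ^ p) (x ^ p)
    Φ-new p∤n x = begin
      Φ (p ℕ.* n) ζ x * Φ n (ζ ^ p) x
        ≈⟨ *-cong (Φ≈∏⊥ (p ℕ.* n) ζ x) (trans (Φ≈∏⊥ n (ζ ^ p) x) (∏⊥-cong n λ a _ _ →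
             +-congˡ {x} (-‿cong (trans (^-assocʳ ζ p a) (reflexive (cong (ζ ^_) (ℕ.*-comm p a))))))) ⟩
      ∏⊥ (p ℕ.* n) (λ a → x - ζ ^ a) * ∏⊥ n (λ a → x - ζ ^ (a ℕ.* p))
        ≈⟨ ∏⊥-new (λ a → x - ζ ^ a) p-prime p∤n ⟩
      ∏⊥ n (λ a → ∏ p (λ j → x - ζ ^ (j ℕ.* n ℕ.+ a)))
        ≈⟨ Φ-residues x ⟨
      Φ n (ζ ^ p) (x ^ p) ∎

  totient : ℕ → ℕ
  totient n = length (totatives n)

  totient-* : ∀ n k → totient n ℕ.* k ≡ Count.∏⊥ n (λ _ → k)
  totient-* n k = ≡.trans (length-* (totatives n)) (Count.foldr-filter (λ a → gcd a n ℕ.≟ 1) (λ _ → k) suc n)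
    where
    length-* : ∀ (as : List ℕ) → length as ℕ.* k ≡ foldr ℕ._+_ 0 (map (λ _ → k) as)
    length-* []       = ≡.refl
    length-* (a ∷ as) = cong (k ℕ.+_) (length-* as)

  totient-∏⊥ : ∀ p n → Count.∏⊥ n (λ _ → Count.∏ p (λ _ → 1)) ≡ totient n ℕ.* p
  totient-∏⊥ p n = ≡.trans (Count.∏⊥-cong n λ _ _ _ → ∏-1 p) (≡.sym (totient-* n p))
    where
    ∏-1 : ∀ m → Count.∏ m (λ _ → 1) ≡ m
    ∏-1 zero    = ≡.refl
    ∏-1 (suc m) = cong suc (∏-1 m)

  totient≡∏⊥ : ∀ n → totient n ≡ Count.∏⊥ n (λ _ → 1)
  totient≡∏⊥ n = ≡.trans (≡.sym (ℕ.*-identityʳ _)) (totient-* n 1)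

  totient-old : ∀ {p n} → p ∣ n → totient (p ℕ.* n) ≡ totient n ℕ.* p
  totient-old {p} {n} p∣n =
    ≡.trans (totient≡∏⊥ (p ℕ.* n)) (≡.trans (Count.∏⊥-old (λ _ → 1) p∣n) (totient-∏⊥ p n))

  totient-new : ∀ {p n} → Prime p → ¬ p ∣ n → totient (p ℕ.* n) ℕ.+ totient n ≡ totient n ℕ.* p
  totient-new {p} {n} pp p∤n =
    ≡.trans (cong₂ ℕ._+_ (totient≡∏⊥ (p ℕ.* n)) (totient≡∏⊥ n))
            (≡.trans (Count.∏⊥-new (λ _ → 1) pp p∤n) (totient-∏⊥ p n))

  -- Integrality

  roots : ℕ → Carrier → List Carrier
  roots n ζ = map (ζ ^_) (totatives n)

  Φ≡∏linear : ∀ n ζ x → Φ n ζ x ≡ ∏linear (roots n ζ) x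
  Φ≡∏linear n ζ x = cong (foldr _*_ 1#) (map-∘ (totatives n))

  roots-distinct : ∀ {n ζ} → IsPrimitiveRoot n ζ → AllPairs (λ r s → ¬ r ≈ s) (roots n ζ)
  roots-distinct {n} prim = AllPairs.map⁺ (AllPairs.filter⁺ (λ a → gcd a n ℕ.≟ 1)
    (AllPairs.applyUpTo⁺₁ suc n λ i<j j<n → powers-distinct prim z<s (s≤s i<j) j<n))

  Φ-∏linear-monic : ∀ n ζ → Monic Whole (totient n) (Φ n ζ)
  Φ-∏linear-monic n ζ = subst (λ d → Monic Whole d (Φ n ζ)) (length-map (ζ ^_) (totatives n))
    (Monic-resp (λ x → reflexive (≡.sym (Φ≡∏linear n ζ x))) (∏linear-monic (roots n ζ)))

  module _ {p n ζ} (p-prime : Prime p) (p∤n : ¬ p ∣ n) (prim : IsPrimitiveRoot (p ℕ.* n) ζ) where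
    private
      instance _ = prime⇒nonZero p-prime
      A = Φ n (ζ ^ p)
      F = Φ (p ℕ.* n) ζ
      rs = roots n (ζ ^ p)

    A-roots : All (λ ρ → A ρ ≈ 0#) rs
    A-roots = All.map (λ {ρ} → trans (reflexive (Φ≡∏linear n (ζ ^ p) ρ))) (∏linear-roots rs)

    -- Φₙ(x^p) is divisible by Φₙ(x) over the integers: the remainder vanishes
    -- at the φ(n) roots of Φₙ.
    Φ-quotient : ∀ {m h r} → Degree< Integral (totient n) r →
                 (∀ x → A (x ^ p) ≈ A x * h x + r x) → Monic Integral m h → m ≡ totient (p ℕ.* n) →
                 ∀ x → h x ≈ F x
    -- With zero remainder, A h and A F are both Φₙ(x^p). The factor A is a product of linear
    -- factors, so it cancels.
    Φ-quotient {h = h} {r} r-deg eq h-monic ≡.refl x = x∙y⁻¹≈ε⇒x≈y _ _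
      (cancel-∏linear infinite rs
        (Closure.Monic-sub wholeSubring (Monic-weaken (λ _ → tt) h-monic) (Φ-∏linear-monic (p ℕ.* n) ζ))
        difference x)
      where
      r-roots : All (λ ρ → r ρ ≈ 0#) rs
      r-roots = All.map (λ {ρ} Aρ≈0 → begin
        r ρ                ≈⟨ +-identityˡ _ ⟨
        0# + r ρ           ≈⟨ +-congʳ (trans (*-congʳ Aρ≈0) (zeroˡ _)) ⟨
        A ρ * h ρ + r ρ    ≈⟨ eq ρ ⟨
        A (ρ ^ p)          ≈⟨ Φ-new p-prime prim p∤n ρ ⟨
        F ρ * A ρ          ≈⟨ trans (*-congˡ Aρ≈0) (zeroʳ _) ⟩
        0#                 ∎) A-roots
      r≈0 : ∀ x → r x ≈ 0#
      r≈0 = vanish rs (roots-distinct (primitive-power prim)) r-roots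
        (subst (λ d → Degree< Whole d r) (≡.sym (length-map ((ζ ^ p) ^_) (totatives n)))
          (Degree<-weaken (λ _ → tt) r-deg))
      difference : ∀ x → ∏linear rs x * (h x - F x) ≈ 0#
      difference x = begin
        ∏linear rs x * (h x - F x)   ≡⟨ cong (_* (h x - F x)) (Φ≡∏linear n (ζ ^ p) x) ⟨
        A x * (h x - F x)            ≈⟨ x[y-z]≈xy-xz _ _ _ ⟩
        A x * h x - A x * F x        ≈⟨ +-congʳ (trans (+-congˡ (r≈0 x)) (+-identityʳ _)) ⟨
        A x * h x + r x - A x * F x  ≈⟨ +-congʳ (eq x) ⟨
        A (x ^ p) - A x * F x
          ≈⟨ +-congˡ (-‿cong (trans (*-comm _ _) (Φ-new p-prime prim p∤n x))) ⟩
        A (x ^ p) - A (x ^ p)        ≈⟨ -‿inverseʳ _ ⟩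
        0#                           ∎

  -- Integrality in the case `new`: long division keeps integer coefficients, and `Φ-quotient`
  -- identifies its quotient with Φ for p n.
  Φ-monic : ∀ {n t ps} → Shape n t ps → ∀ {ζ} → IsPrimitiveRoot n ζ → Monic Integral (totient n) (Φ n ζ)
  Φ-monic unit {ζ} prim = horner (0 , 1 , (begin
      - ζ              ≈⟨ -‿cong (trans (sym (*-identityʳ ζ)) ζⁿ≈1) ⟩
      - 1#             ≈⟨ trans (+-identityˡ _) (-‿cong (+-identityʳ 1#)) ⟨
      0# - (1# + 0#)   ∎)) (one {f = λ _ → 1#} λ _ → refl) λ x →
      trans (*-identityʳ _) (+-cong (sym (*-identityʳ x)) (-‿cong (*-identityʳ ζ)))
    where open IsPrimitiveRoot prim
  Φ-monic (old {suc k} {n} pp p∈ s) {ζ} prim =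
    subst (λ d → Monic Integral d (Φ (suc k ℕ.* n) ζ)) (≡.sym (totient-old p∣n))
      (Monic-resp (λ x → sym (Φ-old pp prim p∣n x))
        (Closure.Monic-∘^ integralSubring k (Φ-monic s {ζ ^ suc k} (primitive-power {suc k} prim))))
    where p∣n = shape-∈⇒∣ s p∈
  Φ-monic (new {zero} pp _ _) = contradiction pp ¬prime[0]
  Φ-monic (new {p@(suc k)} {n} pp p∉ s) {ζ} prim =
    let monic = Φ-monic s {ζ ^ p} (primitive-power {p} prim)
        p∤n = p∉ ∘ shape-∣⇒∈ pp s
        -- By `totient-new` the dividend Φₙ(x^p) has degree φ(p n) + φ(n), so the quotient has
        -- degree φ(p n).
        h , r , h-monic , r-deg , eq = Closure.divide integralSubring (totient (p ℕ.* n)) monic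
           (subst (λ d → Monic Integral d (λ x → Φ n (ζ ^ p) (x ^ p))) (≡.sym (totient-new pp p∤n))
             (Closure.Monic-∘^ integralSubring k monic))
    in Monic-resp (Φ-quotient pp p∤n prim r-deg eq h-monic ≡.refl) h-monic

  Integral-eval : ∀ {n f x} → Monic Integral n f → Integral x → Integral (f x)
  Integral-eval (one eq) _ =
    1 , 0 , trans (eq _) (sym (trans (+-cong (+-identityʳ 1#) -0#≈0#) (+-identityʳ 1#)))
  Integral-eval (horner a p eq) x =
    let c , d , ≈cd = +∈ (*∈ x (Integral-eval p x)) a in c , d , trans (eq _) ≈cd
    where open IsSubring integralSubring

  -- Values

  ·1-∸ : ∀ {x a b} → b ℕ.≤ a → x ≈ a · 1# - b · 1# → x ≈ (a ℕ.∸ b) · 1#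
  ·1-∸ {x} {a} {b} b≤a eq = begin
    x                                       ≈⟨ eq ⟩
    a · 1# - b · 1#                         ≡⟨ cong (λ m → m · 1# - b · 1#) (ℕ.m∸n+n≡m b≤a) ⟨
    (a ℕ.∸ b ℕ.+ b) · 1# - b · 1#           ≈⟨ +-congʳ (×-homo-+ 1# (a ℕ.∸ b) b) ⟩
    ((a ℕ.∸ b) · 1# + b · 1#) - b · 1#      ≈⟨ +-assoc _ _ _ ⟩
    (a ℕ.∸ b) · 1# + (b · 1# - b · 1#)      ≈⟨ trans (+-congˡ (-‿inverseʳ _)) (+-identityʳ _) ⟩
    (a ℕ.∸ b) · 1#                          ∎

  -- For x = a - b, moving b A to the other side gives a A = B + b A between naturals, where
  -- characteristic zero applies. Hence b ≤ a, and V = a - b.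
  integral-quotient : ∀ {x A B} → Integral x → 0 ℕ.< A → 0 ℕ.< B → x * A · 1# ≈ B · 1# →
                      ∃[ V ] 0 ℕ.< V × V ℕ.* A ≡ B × x ≈ V · 1#
  integral-quotient {x} {A} {B} (a , b , x≈) 0<A 0<B xA≈B = V , 0<V , VA≡B , x≈V
    where
    instance _ = ℕ.>-nonZero 0<A
    aA≡B+bA : a ℕ.* A ≡ B ℕ.+ b ℕ.* A
    aA≡B+bA = ·1-injective (begin
      (a ℕ.* A) · 1#                       ≈⟨ ×1-homo-* a A ⟩
      a · 1# * A · 1#                      ≈⟨ *-congʳ (begin
        x + b · 1#                 ≈⟨ +-congʳ x≈ ⟩
        (a · 1# - b · 1#) + b · 1# ≈⟨ trans (+-assoc _ _ _) (trans (+-congˡ (-‿inverseˡ _)) (+-identityʳ _)) ⟩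
        a · 1#                     ∎) ⟨
      (x + b · 1#) * A · 1#                ≈⟨ distribʳ _ _ _ ⟩
      x * A · 1# + b · 1# * A · 1#         ≈⟨ +-cong xA≈B (sym (×1-homo-* b A)) ⟩
      B · 1# + (b ℕ.* A) · 1#              ≈⟨ ×-homo-+ 1# B _ ⟨
      (B ℕ.+ b ℕ.* A) · 1#                 ∎)
    b≤a : b ℕ.≤ a
    b≤a = ℕ.*-cancelʳ-≤ b a A (subst (b ℕ.* A ℕ.≤_) (≡.sym aA≡B+bA) (ℕ.m≤n+m _ B))
    V = a ℕ.∸ b
    VA≡B : V ℕ.* A ≡ B
    VA≡B = ≡.trans (ℕ.*-distribʳ-∸ A a b)
      (≡.trans (cong (ℕ._∸ b ℕ.* A) aA≡B+bA) (ℕ.m+n∸n≡m B (b ℕ.* A)))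
    x≈V : x ≈ V · 1#
    x≈V = ·1-∸ b≤a x≈
    0<V : 0 ℕ.< V
    0<V = ℕ.n≢0⇒n>0 λ V≡0 → ℕ.<⇒≢ 0<B (≡.trans (cong (ℕ._* A) (≡.sym V≡0)) VA≡B)

  -- Stated for all q because the induction passes from q to q^p. Positivity is carried along for
  -- the division by A in the case `new`.
  Φ-value : ∀ {n t ps} → Shape n t ps → ∀ {ζ} → IsPrimitiveRoot n ζ → ∀ q → 2 ℕ.≤ q →
            ∃[ V ] 0 ℕ.< V × Quotient ps (q ℕ.^ t) V × Φ n ζ (q · 1#) ≈ V · 1#
  Φ-value unit {ζ} prim q@(suc r) (s≤s 0<r) = r , 0<r , base (≡.sym (ℕ.*-identityʳ q)) , (begin
      (q · 1# - ζ ^ 1) * 1#  ≈⟨ *-identityʳ _ ⟩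
      q · 1# - ζ ^ 1         ≈⟨ +-congˡ (-‿cong (trans ζⁿ≈1 (sym (+-identityʳ 1#)))) ⟩
      q · 1# - 1 · 1#        ≈⟨ ·1-∸ {a = q} {1} (s≤s z≤n) refl ⟩
      r · 1#                 ∎)
    where open IsPrimitiveRoot prim
  Φ-value (old {p} {n} {t} {ps} pp p∈ s) {ζ} prim q 2≤q =
    let instance _ = prime⇒nonZero pp
        V , 0<V , quot , eq = Φ-value s (primitive-power prim) (q ℕ.^ p) (2≤^ pp 2≤q)
    in V , 0<V , subst (λ y → Quotient ps y V) (ℕ.^-*-assoc q p t) quot , (begin
      Φ (p ℕ.* n) ζ (q · 1#)          ≈⟨ Φ-old pp prim (shape-∈⇒∣ s p∈) _ ⟩
      Φ n (ζ ^ p) ((q · 1#) ^ p)      ≈⟨ Monic-cong (Φ-monic s (primitive-power prim)) (·1-^ q p) ⟩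
      Φ n (ζ ^ p) ((q ℕ.^ p) · 1#)    ≈⟨ eq ⟩
      V · 1#                          ∎)
  Φ-value (new {p} {n} {t} {ps} pp p∉ s) {ζ} prim q 2≤q =
    let instance _ = prime⇒nonZero pp
        A , 0<A , quotA , eqA = Φ-value s (primitive-power prim) q 2≤q
        B , 0<B , quotB , eqB = Φ-value s (primitive-power prim) (q ℕ.^ p) (2≤^ pp 2≤q)
        V , 0<V , VA≡B , eqV = integral-quotient
          (Integral-eval (Φ-monic (new pp p∉ s) prim) (q , 0 , sym (trans (+-congˡ -0#≈0#) (+-identityʳ _))))
          0<A 0<B (begin
            Φ (p ℕ.* n) ζ (q · 1#) * A · 1#             ≈⟨ *-congˡ eqA ⟨
            Φ (p ℕ.* n) ζ (q · 1#) * Φ n (ζ ^ p) (q · 1#) ≈⟨ Φ-new pp prim (p∉ ∘ shape-∣⇒∈ pp s) _ ⟩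
            Φ n (ζ ^ p) ((q · 1#) ^ p)   ≈⟨ Monic-cong (Φ-monic s (primitive-power prim)) (·1-^ q p) ⟩
            Φ n (ζ ^ p) ((q ℕ.^ p) · 1#) ≈⟨ eqB ⟩
            B · 1#                       ∎)
    in V , 0<V , step quotA (subst (λ y → Quotient ps y B) (^-comm q p t) quotB) VA≡B , eqV

-- Positive fractions

module Ordering where
  open import Data.List.Membership.DecPropositional ℕ._≟_ using (_∈?_)
  open import Data.Nat.Base hiding (_/_)
  open import Data.Nat.Properties
  open ≡ using (refl)

  infixl 7 _·_
  infix  8 _⁻¹
  infix  4 _≼_ _≃_

  -- Unreduced positive fractions: inversion is total, comparison is cross multiplication, and
  -- products form an abelian group up to `_≃_`.
  record ℚ⁺ : Set where
    constructor _/_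
    field
      num den : ℕ
      .{{num≢0}} : NonZero num
      .{{den≢0}} : NonZero den
  open ℚ⁺

  1ℚ : ℚ⁺
  1ℚ = 1 / 1

  record _≼_ (a b : ℚ⁺) : Set where
    constructor cross
    field uncross : num a * den b ≤ num b * den a

  _≃_ : ℚ⁺ → ℚ⁺ → Set
  a ≃ b = a ≼ b × b ≼ a

  opaque
    _·_ : ℚ⁺ → ℚ⁺ → ℚ⁺
    a · b = _/_ (num a * num b) (den a * den b) {{m*n≢0 (num a) (num b)}} {{m*n≢0 (den a) (den b)}}

    _⁻¹ : ℚ⁺ → ℚ⁺
    a ⁻¹ = den a / num a

    ≼-refl : ∀ {a} → a ≼ a
    ≼-refl = cross ≤-refl

    ≼-trans : ∀ {a b c} → a ≼ b → b ≼ c → a ≼ c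
    ≼-trans {a} {b} {c} (cross p) (cross q) = cross (*-cancelʳ-≤ _ _ (den b) (begin
      num a * den c * den b  ≡⟨ xy∙z≈xz∙y (num a) (den c) (den b) ⟩
      num a * den b * den c  ≤⟨ *-monoˡ-≤ (den c) p ⟩
      num b * den a * den c  ≡⟨ xy∙z≈xz∙y (num b) (den a) (den c) ⟩
      num b * den c * den a  ≤⟨ *-monoˡ-≤ (den a) q ⟩
      num c * den b * den a  ≡⟨ xy∙z≈xz∙y (num c) (den b) (den a) ⟩
      num c * den a * den b  ∎))
      where
      open ≤-Reasoning
      open import Algebra.Properties.CommutativeSemigroup *-commutativeSemigroup using (xy∙z≈xz∙y)

    ·-mono : ∀ {a b c d} → a ≼ b → c ≼ d → a · c ≼ b · d
    ·-mono {a} {b} {c} {d} (cross p) (cross q) = cross (subst₂ _≤_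
      (interchange (num a) (den b) (num c) (den d)) (interchange (num b) (den a) (num d) (den c))
      (*-mono-≤ p q))
      where open import Algebra.Properties.CommutativeSemigroup *-commutativeSemigroup using (interchange)

    ⁻¹-anti : ∀ {a b} → a ≼ b → b ⁻¹ ≼ a ⁻¹
    ⁻¹-anti {a} {b} (cross p) = cross (subst₂ _≤_ (*-comm (num a) _) (*-comm (num b) _) p)

    ≡⇒≃ : ∀ {a b} → num a ≡ num b → den a ≡ den b → a ≃ b
    ≡⇒≃ p q = cross (≤-reflexive (cong₂ _*_ p (≡.sym q))) , cross (≤-reflexive (cong₂ _*_ (≡.sym p) q))

    ≃-trans : ∀ {a b c} → a ≃ b → b ≃ c → a ≃ c
    ≃-trans (p , p′) (q , q′) = ≼-trans p q , ≼-trans q′ p′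

    ·-inverseʳ : ∀ a → a · a ⁻¹ ≃ 1ℚ
    ·-inverseʳ a = cross (≤-reflexive eq) , cross (≤-reflexive (≡.sym eq))
      where
      eq : num a * den a * 1 ≡ 1 * (den a * num a)
      eq = ≡.trans (*-identityʳ _) (≡.trans (*-comm (num a) (den a)) (≡.sym (*-identityˡ _)))

    ·-comm : ∀ a b → a · b ≃ b · a
    ·-comm a b = ≡⇒≃ (*-comm (num a) _) (*-comm (den a) _)

    1≼⁻¹ : ∀ {a} → a ≼ 1ℚ → 1ℚ ≼ a ⁻¹
    1≼⁻¹ = ⁻¹-anti {b = 1ℚ}

    ·-assoc : ∀ a b c → a · b · c ≃ a · (b · c)
    ·-assoc a b c = ≡⇒≃ (*-assoc (num a) _ _) (*-assoc (den a) _ _)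

    ·-identityˡ : ∀ a → 1ℚ · a ≃ a
    ·-identityˡ a = ≡⇒≃ (*-identityˡ _) (*-identityˡ _)

  ·-isAbelianGroup : IsAbelianGroup _≃_ _·_ 1ℚ _⁻¹
  ·-isAbelianGroup = record
    { isGroup = record
      { isMonoid = record
        { isSemigroup = record
          { isMagma = record
            { isEquivalence = record { refl = ≼-refl , ≼-refl ; sym = swap ; trans = ≃-trans }
            ; ∙-cong = λ (p , p′) (q , q′) → ·-mono p q , ·-mono p′ q′
            }
          ; assoc = ·-assoc
          }
        ; identity = ·-identityˡ , λ a → ≃-trans (·-comm a 1ℚ) (·-identityˡ a)
        }
      ; inverse = (λ a → ≃-trans (·-comm (a ⁻¹) a) (·-inverseʳ a)) , ·-inverseʳ
      ; ⁻¹-cong = λ (p , p′) → ⁻¹-anti p′ , ⁻¹-anti p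
      }
    ; comm = ·-comm
    }

  ℚ⁺-abelianGroup : AbelianGroup 0ℓ 0ℓ
  ℚ⁺-abelianGroup = record { isAbelianGroup = ·-isAbelianGroup }

  module Q where
    open AbelianGroup ℚ⁺-abelianGroup public hiding (_⁻¹)
    open Algebra.Properties.AbelianGroup ℚ⁺-abelianGroup public
    open import Algebra.Properties.CommutativeSemigroup commutativeSemigroup public
      using (x∙yz≈y∙xz; interchange)
    open RangeProduct commutativeMonoid public

  ·-monoˡ : ∀ c {a b} → a ≼ b → c · a ≼ c · b
  ·-monoˡ c = ·-mono (≼-refl {c})

  ·-monoʳ : ∀ c {a b} → a ≼ b → a · c ≼ b · c
  ·-monoʳ c p = ·-mono p (≼-refl {c})

  shrink : ∀ {a b} → a ≼ 1ℚ → a · b ≼ b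
  shrink {b = b} a≼1 = ≼-trans (·-monoʳ b a≼1) (proj₁ (Q.identityˡ b))

  grow : ∀ {a b} → 1ℚ ≼ a → b ≼ a · b
  grow {b = b} 1≼a = ≼-trans (proj₂ (Q.identityˡ b)) (·-monoʳ b 1≼a)

  ·≼⇒≼⁻¹· : ∀ a {b c} → a · b ≼ c → b ≼ a ⁻¹ · c
  ·≼⇒≼⁻¹· a {b} {c} p = ≼-trans (proj₂ (Q.\\-leftDividesʳ a b)) (·-monoˡ (a ⁻¹) p)

  -- Products with exponents 1, -1 and 0

  infixr 9 _^ˢ_
  _^ˢ_ : ℚ⁺ → Maybe Sign → ℚ⁺
  a ^ˢ just Sign.+ = a
  a ^ˢ just Sign.- = a ⁻¹
  a ^ˢ nothing     = 1ℚ

  -- Exponents differing by at most 1: the only pair left out is 1 against -1.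
  data Compatible : Maybe Sign → Maybe Sign → Set where
    same    : ∀ {s} → Compatible s s
    noneˡ   : ∀ {s} → Compatible nothing (just s)
    noneʳ   : ∀ {s} → Compatible (just s) nothing

  Compatible-sym : ∀ {s t} → Compatible s t → Compatible t s
  Compatible-sym same  = same
  Compatible-sym noneˡ = noneʳ
  Compatible-sym noneʳ = noneˡ

  Compatible-nothing : ∀ s → Compatible s nothing
  Compatible-nothing (just _) = noneʳ
  Compatible-nothing nothing  = same

  -- Models f i = 1 - y^-(i+1) for y ≥ 2.
  record Slow (f : ℕ → ℚ⁺) : Set where
    field
      ≼1     : ∀ i → f i ≼ 1ℚ
      ≼square : ∀ i → f i ≼ f (suc i) · f (suc i)

    ≼suc : ∀ i → f i ≼ f (suc i)
    ≼suc i = ≼-trans (≼square i) (shrink (≼1 (suc i)))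

  Slow-suc : ∀ {f} → Slow f → Slow (f ∘ suc)
  Slow-suc slow = record { ≼1 = ≼1 ∘ suc ; ≼square = ≼square ∘ suc }
    where open Slow slow

  infix 5 _^ˢ[_]_
  _^ˢ[_]_ : (ℕ → ℚ⁺) → ℕ → (ℕ → Maybe Sign) → ℚ⁺
  f ^ˢ[ k ] s = Q.∏ k (λ i → f i ^ˢ s i)

  ^ˢ[]-nothing : ∀ f k → f ^ˢ[ k ] (λ _ → nothing) ≃ 1ℚ
  ^ˢ[]-nothing f k = Q.∏-ε k λ _ _ → Q.refl {1ℚ}

  -- As f i ≼ (f (suc i))², all later factors together weigh at most as much as
  -- the factor in front of them.
  head≼tail : ∀ k {f} → Slow f → ∀ {s s′} → (∀ i → Compatible (s i) (s′ i)) →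
              f 0 · (f ∘ suc ^ˢ[ k ] s′) ≼ (f ∘ suc ^ˢ[ k ] s)
  head≼tail zero    {f} slow comp = shrink {b = 1ℚ} (Slow.≼1 slow 0)
  head≼tail (suc k) {f} slow {s} {s′} comp =
    prepend {f ∘ suc ∘ suc ^ˢ[ k ] s ∘ suc} {f ∘ suc ∘ suc ^ˢ[ k ] s′ ∘ suc}
      (s 0) (s′ 0) (comp 0) (head≼tail k (Slow-suc slow) (comp ∘ suc))
    where
    open Slow slow
    prepend : ∀ {T T′} u u′ → Compatible u u′ → f 1 · T′ ≼ T → f 0 · (f 1 ^ˢ u′ · T′) ≼ f 1 ^ˢ u · T
    prepend {T} {T′} u u same ih = ≼-trans (proj₁ (Q.x∙yz≈y∙xz (f 0) (f 1 ^ˢ u) T′))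
      (·-monoˡ (f 1 ^ˢ u) (≼-trans (·-monoʳ T′ (≼suc 0)) ih))
    -- Here and in the last case the exponents differ in the unfavourable direction. One factor of
    -- (f 1)² pays for the difference, the other is spent on the induction hypothesis.
    prepend {T} {T′} (just Sign.+) nothing noneʳ ih =
      ≼-trans (·-mono (≼square 0) (proj₁ (Q.identityˡ T′)))
        (≼-trans (proj₁ (Q.assoc (f 1) (f 1) T′)) (·-monoˡ (f 1) ih))
    prepend {T} {T′} (just Sign.-) nothing noneʳ ih =
      ≼-trans (·-mono (≼suc 0) (proj₁ (Q.identityˡ T′))) (≼-trans ih (grow (1≼⁻¹ (≼1 1))))
    prepend {T} {T′} nothing (just Sign.+) noneˡ ih =
      ≼-trans (shrink (≼1 0)) (≼-trans ih (proj₂ (Q.identityˡ T)))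
    prepend {T} {T′} nothing (just Sign.-) noneˡ ih =
      ≼-trans (·-monoʳ (f 1 ⁻¹ · T′) (≼square 0)) (≼-trans (proj₁ (Q.assoc (f 1) (f 1) (f 1 ⁻¹ · T′)))
        (≼-trans (·-monoˡ (f 1) (proj₁ (Q.\\-leftDividesˡ (f 1) T′)))
          (≼-trans ih (proj₂ (Q.identityˡ T)))))

  -- The alternative stands outside the quantifier over f: the exponents alone decide it. This is
  -- what makes the direction the same for all q.
  first-difference : ∀ k s s′ → (∀ i → Compatible (s i) (s′ i)) →
            (∀ {f} → Slow f → (f ^ˢ[ k ] s) ≼ (f ^ˢ[ k ] s′)) ⊎
            (∀ {f} → Slow f → (f ^ˢ[ k ] s′) ≼ (f ^ˢ[ k ] s))
  first-difference zero    s s′ comp = inj₁ λ _ → ≼-refl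
  first-difference (suc k) s s′ comp = go (s 0) (s′ 0) (comp 0)
    where
    shift : ∀ u {t t′} → (∀ {f} → Slow f → (f ^ˢ[ k ] t ∘ suc) ≼ (f ^ˢ[ k ] t′ ∘ suc)) →
            ∀ {f} → Slow f → f 0 ^ˢ u · (f ∘ suc ^ˢ[ k ] t ∘ suc) ≼ f 0 ^ˢ u · (f ∘ suc ^ˢ[ k ] t′ ∘ suc)
    shift u {t} {t′} h {f} slow = ·-monoˡ (f 0 ^ˢ u)
      {f ∘ suc ^ˢ[ k ] t ∘ suc} {f ∘ suc ^ˢ[ k ] t′ ∘ suc} (h (Slow-suc slow))
    below : ∀ {t t′} → (∀ i → Compatible (t i) (t′ i)) → ∀ {f} → Slow f →
            f 0 · (f ∘ suc ^ˢ[ k ] t) ≼ 1ℚ · (f ∘ suc ^ˢ[ k ] t′)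
    below {t} {t′} comp {f} slow = ≼-trans (head≼tail k slow {t′} {t} (Compatible-sym ∘ comp))
      (proj₂ (Q.identityˡ (f ∘ suc ^ˢ[ k ] t′)))
    above : ∀ {t t′} → (∀ i → Compatible (t i) (t′ i)) → ∀ {f} → Slow f →
            1ℚ · (f ∘ suc ^ˢ[ k ] t′) ≼ f 0 ⁻¹ · (f ∘ suc ^ˢ[ k ] t)
    above {t′ = t′} comp {f} slow = ≼-trans (proj₁ (Q.identityˡ (f ∘ suc ^ˢ[ k ] t′)))
      (·≼⇒≼⁻¹· (f 0) (head≼tail k slow comp))
    go : ∀ u u′ → Compatible u u′ →
         (∀ {f} → Slow f → f 0 ^ˢ u · (f ∘ suc ^ˢ[ k ] s ∘ suc) ≼ f 0 ^ˢ u′ · (f ∘ suc ^ˢ[ k ] s′ ∘ suc)) ⊎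
         (∀ {f} → Slow f → f 0 ^ˢ u′ · (f ∘ suc ^ˢ[ k ] s′ ∘ suc) ≼ f 0 ^ˢ u · (f ∘ suc ^ˢ[ k ] s ∘ suc))
    go u u same with first-difference k (s ∘ suc) (s′ ∘ suc) (comp ∘ suc)
    ... | inj₁ h = inj₁ (shift u {s} {s′} h)
    ... | inj₂ h = inj₂ (shift u {s′} {s} h)
    go nothing (just Sign.+) noneˡ = inj₂ (below (Compatible-sym ∘ comp ∘ suc))
    go nothing (just Sign.-) noneˡ = inj₁ (above (Compatible-sym ∘ comp ∘ suc))
    go (just Sign.+) nothing noneʳ = inj₁ (below (comp ∘ suc))
    go (just Sign.-) nothing noneʳ = inj₂ (above (comp ∘ suc))

  module _ {f} (slow : Slow f) where
    -- `head≼tail` against the exponents that are all zero; `tail≼` is the mirror image.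
    tail≽ : ∀ k s → f 0 ≼ (f ∘ suc ^ˢ[ k ] s)
    tail≽ k s = ≼-trans (proj₂ (Q.identityʳ (f 0)))
      (≼-trans (·-monoˡ (f 0) (proj₂ (^ˢ[]-nothing (f ∘ suc) k))) (head≼tail k slow (Compatible-nothing ∘ s)))

    tail≼ : ∀ k s → (f ∘ suc ^ˢ[ k ] s) ≼ f 0 ⁻¹
    tail≼ k s = ≼-trans (·≼⇒≼⁻¹· (f 0) (≼-trans (head≼tail k slow (Compatible-sym ∘ Compatible-nothing ∘ s))
      (proj₁ (^ˢ[]-nothing (f ∘ suc) k)))) (proj₁ (Q.identityʳ _))

  -- If the first nonzero exponent is -1, the inverse of that factor outweighs everything after it,
  -- by `tail≽`.
  1≼negative-first : ∀ k {f} → Slow f → ∀ s →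
                     (∀ i → s i ≡ just Sign.+ → ∃[ j ] j < i × s j ≡ just Sign.-) → 1ℚ ≼ (f ^ˢ[ k ] s)
  1≼negative-first zero    slow s neg = ≼-refl
  1≼negative-first (suc k) {f} slow s neg with s 0 in eq
  ... | just Sign.+ with () ← proj₁ (proj₂ (neg 0 eq))
  ... | just Sign.- = ≼-trans (proj₂ (Q.inverseˡ (f 0))) (·-monoˡ (f 0 ⁻¹) (tail≽ slow k (s ∘ suc)))
  ... | nothing = ≼-trans (1≼negative-first k (Slow-suc slow) (s ∘ suc) neg′) (proj₂ (Q.identityˡ _))
    where
    neg′ : ∀ i → s (suc i) ≡ just Sign.+ → ∃[ j ] j < i × s (suc j) ≡ just Sign.-
    neg′ i si with neg (suc i) si
    ... | zero  , _       , s0 = contradiction (≡.trans (≡.sym eq) s0) λ ()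
    ... | suc j , s<s j<i , sj = j , j<i , sj

  -- The factors 1 - 1/x and the product formula

  -- The fractions (x - 1)/x and x/1, totalised by junk values at x < 2 and x < 1.
  w : ℕ → ℚ⁺
  w x = suc (x ∸ 2) / suc (suc (x ∸ 2))

  ⟦_⟧ : ℕ → ℚ⁺
  ⟦ x ⟧ = suc (x ∸ 1) / 1

  w≼1 : ∀ x → w x ≼ 1ℚ
  w≼1 x = cross (≤-trans (≤-reflexive (*-identityʳ _))
    (≤-trans (n≤1+n _) (≤-reflexive (≡.sym (+-identityʳ _)))))

  w-mono : ∀ {x y} → x ≤ y → w x ≼ w y
  w-mono {x} {y} x≤y = cross (lemma (x ∸ 2) (y ∸ 2) (∸-monoˡ-≤ 2 x≤y))
    where
    lemma : ∀ a b → a ≤ b → suc a * suc (suc b) ≤ suc b * suc (suc a)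
    lemma a b a≤b = subst₂ _≤_ (lhs a b) (rhs a b) (+-monoˡ-≤ (a * b + 2 + a + b) a≤b)
      where
      lhs : ∀ a b → a + (a * b + 2 + a + b) ≡ suc a * suc (suc b)
      lhs = solve-∀
      rhs : ∀ a b → b + (a * b + 2 + a + b) ≡ suc b * suc (suc a)
      rhs = solve-∀

  opaque
    unfolding _·_
    -- (1 - 1/(2x))² exceeds 1 - 1/x by 1/(4x²). After cross multiplication this is the slack x = 2
    -- + a.
    w-double : ∀ a → w (2 + a) ≼ w (2 * (2 + a)) · w (2 * (2 + a))
    w-double a = cross (≤-trans (m≤m+n _ (2 + a)) (≤-reflexive (eq a)))
      where
      eq : ∀ a → let c = a + suc (suc (a + 0)) in
           suc a * (suc (suc c) * suc (suc c)) + (2 + a) ≡ suc c * suc c * suc (suc a)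
      eq = solve-∀

  w-square : ∀ {x y} → 2 ≤ x → 2 * x ≤ y → w x ≼ w y · w y
  w-square {suc (suc a)} (s≤s (s≤s z≤n)) 2x≤y =
    ≼-trans (w-double a) (·-mono (w-mono 2x≤y) (w-mono 2x≤y))

  weights : ℕ → ℕ → ℚ⁺
  weights y i = w (y ^ suc i)

  x≤x^ : ∀ x n .{{_ : NonZero x}} .{{_ : NonZero n}} → x ≤ x ^ n
  x≤x^ x (suc n) = m≤m*n x (x ^ n) {{m^n≢0 x n}}

  weights-slow : ∀ {y} → 2 ≤ y → Slow (weights y)
  weights-slow {y} 2≤y = record
    { ≼1 = λ i → w≼1 (y ^ suc i)
    ; ≼square = λ i → w-square (≤-trans 2≤y (x≤x^ y (suc i))) (*-monoˡ-≤ (y ^ suc i) 2≤y)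
    }
    where instance _ = >-nonZero (<-≤-trans z<s 2≤y)

  -- ⟦ V ⟧ for V = Φ_{∏ ps}(y) is y^φ(ps) F ps y, where F ps y is the product of
  -- the (1 - y^-d)^μ(∏ ps / d).  F′ ps y has the exponents μ(d) instead.
  F′ : List ℕ → ℕ → ℚ⁺
  F′ []       y = w y
  F′ (p ∷ ps) y = F′ ps y · F′ ps (y ^ p) ⁻¹

  alternate : ℕ → Sign
  alternate zero    = Sign.+
  alternate (suc n) = opposite (alternate n)

  sign : List ℕ → Sign
  sign ps = alternate (length ps)

  F : List ℕ → ℕ → ℚ⁺
  F ps y = F′ ps y ^ˢ just (sign ps)

  φ : List ℕ → ℕ
  φ []       = 1
  φ (p ∷ ps) = (p ∸ 1) * φ ps

  -- One more prime flips the sign, which turns the recursion of `F′` upside down into that of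
  -- `Quotient`.
  F-∷ : ∀ p ps y → F (p ∷ ps) y ≃ F ps (y ^ p) · F ps y ⁻¹
  F-∷ p ps y with sign ps
  ... | Sign.+ = Q.⁻¹-anti-homo-// (F′ ps y) (F′ ps (y ^ p))
  ... | Sign.- = Q.trans (Q.comm _ _) (Q.∙-congˡ (Q.sym (Q.⁻¹-involutive (F′ ps y))))

  opaque
    unfolding _·_
    ⟦⟧-* : ∀ m n .{{_ : NonZero m}} .{{_ : NonZero n}} → ⟦ m * n ⟧ ≃ ⟦ m ⟧ · ⟦ n ⟧
    ⟦⟧-* (suc m) (suc n) = ≡⇒≃ refl refl

    ⟦⟧-w : ∀ {V} .{{_ : NonZero V}} → ⟦ V ⟧ ≃ ⟦ suc V ⟧ · w (suc V)
    ⟦⟧-w {suc V} = cross (≤-reflexive (eq V)) , cross (≤-reflexive (≡.sym (eq V)))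
      where
      eq : ∀ V → suc V * (1 * suc (suc V)) ≡ suc (suc V) * suc V * 1
      eq = solve-∀

  -- The recursion V A = B splits into one for the powers of y, where (p - 1) φ + φ = p φ, and one
  -- for `F`, which is `F-∷`.
  value : ∀ {ps y V} → All Prime ps → 2 ≤ y → Quotient ps y V → NonZero V × ⟦ V ⟧ ≃ ⟦ y ^ φ ps ⟧ · F ps y
  value {y = suc V} [] (s≤s 1≤V) (base refl) = V≢0 ,
    Q.trans (⟦⟧-w {V} {{V≢0}}) (Q.∙-congʳ {w (suc V)} (Q.reflexive (cong ⟦_⟧ (≡.sym (*-identityʳ (suc V))))))
    where V≢0 = >-nonZero 1≤V
  value {p ∷ ps} {y} {V} (pp ∷ primes) 2≤y (step {A = A} {B} quotA quotB VA≡B) =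
    V≢0 , Q.trans (Q.∙-cancelʳ ⟦ A ⟧ ⟦ V ⟧ (a · (c · d ⁻¹)) eq) (Q.∙-congˡ {a} (Q.sym (F-∷ p ps y)))
    where
    instance
      y≢0 = >-nonZero (<-≤-trans z<s 2≤y)
      A≢0 = proj₁ (value primes 2≤y quotA)
      B≢0 = proj₁ (value primes (2≤^ pp 2≤y) quotB)
      V≢0 : NonZero V
      V≢0 = ≢-nonZero λ V≡0 → ≢-nonZero⁻¹ B (≡.trans (≡.sym VA≡B) (cong (_* A) V≡0))
    a = ⟦ y ^ φ (p ∷ ps) ⟧
    b = ⟦ y ^ φ ps ⟧
    c = F ps (y ^ p)
    d = F ps y
    ab : a · b ≃ ⟦ (y ^ p) ^ φ ps ⟧
    ab = Q.trans (Q.sym (⟦⟧-* (y ^ φ (p ∷ ps)) (y ^ φ ps) {{m^n≢0 y (φ (p ∷ ps))}} {{m^n≢0 y (φ ps)}}))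
      (Q.reflexive (cong ⟦_⟧ (≡.trans (≡.sym (^-distribˡ-+-* y (φ (p ∷ ps)) (φ ps)))
        (≡.trans (cong (y ^_) (exponent p {{prime⇒nonZero pp}})) (≡.sym (^-*-assoc y p (φ ps)))))))
      where
      exponent : ∀ p .{{_ : NonZero p}} → (p ∸ 1) * φ ps + φ ps ≡ p * φ ps
      exponent (suc k) = +-comm (k * φ ps) (φ ps)
    eq : ⟦ V ⟧ · ⟦ A ⟧ ≃ a · (c · d ⁻¹) · ⟦ A ⟧
    eq = begin
      ⟦ V ⟧ · ⟦ A ⟧              ≈⟨ ⟦⟧-* V A ⟨
      ⟦ V * A ⟧                  ≡⟨ cong ⟦_⟧ VA≡B ⟩
      ⟦ B ⟧                      ≈⟨ proj₂ (value primes (2≤^ pp 2≤y) quotB) ⟩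
      ⟦ (y ^ p) ^ φ ps ⟧ · c     ≈⟨ Q.∙-congʳ {c} ab ⟨
      a · b · c                  ≈⟨ Q.∙-congˡ {a · b} (Q.//-rightDividesˡ d c) ⟨
      a · b · (c · d ⁻¹ · d)     ≈⟨ Q.interchange a b (c · d ⁻¹) d ⟩
      a · (c · d ⁻¹) · (b · d)   ≈⟨ Q.∙-congˡ {a · (c · d ⁻¹)} (proj₂ (value primes 2≤y quotA)) ⟨
      a · (c · d ⁻¹) · ⟦ A ⟧     ∎
      where open import Relation.Binary.Reasoning.Setoid Q.setoid

  -- The exponents and Liouville's function

  -- λ(d) = s for Liouville's function λ.
  Liouville : ℕ → Sign → Set
  Liouville d s = ∃[ qs ] d ≡ product qs × All Prime qs × s ≡ sign qs

  Liouville-unique : ∀ {d s s′} → Liouville d s → Liouville d s′ → s ≡ s′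
  Liouville-unique {d} (qs , d≡ , primes , refl) (qs′ , d≡′ , primes′ , refl) = cong alternate (↭-length
    (factorisationUnique
      (record { factors = qs ; isFactorisation = d≡ ; factorsPrime = primes })
      (record { factors = qs′ ; isFactorisation = d≡′ ; factorsPrime = primes′ })))

  Liouville-prime : ∀ {p} → Prime p → Liouville p Sign.-
  Liouville-prime {p} pp = p ∷ [] , ≡.sym (*-identityʳ p) , pp ∷ [] , refl

  data PrimeSet : List ℕ → Set where
    []     : PrimeSet []
    insert : ∀ {p ps} → Prime p → p ∉ ps → PrimeSet ps → PrimeSet (p ∷ ps)

  allPrime : ∀ {ps} → PrimeSet ps → All Prime ps
  allPrime []           = []
  allPrime (insert pp _ S) = pp ∷ allPrime S

  ∤product : ∀ {p ps} → Prime p → p ∉ ps → PrimeSet ps → ¬ p ∣ product ps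
  ∤product pp p∉ S p∣ = p∉ (factorisationHasAllPrimeFactors pp p∣ (allPrime S))

  -- The effect on exponents of y ↦ y^p, as 1 - (y^p)^-k is 1 - y^-(k p).
  scale : ℕ → (ℕ → Maybe Sign) → ℕ → Maybe Sign
  scale p s d with p ∣? d
  ... | yes (divides k _) = s k
  ... | no _              = nothing

  scale-just : ∀ p s d {u} → scale p s d ≡ just u → ∃[ k ] d ≡ k * p × s k ≡ just u
  scale-just p s d eq with p ∣? d
  ... | yes (divides k d≡kp) = k , d≡kp , eq
  scale-just p s d () | no _

  scale-multiple : ∀ p .{{_ : NonZero p}} s k → scale p s (k * p) ≡ s k
  scale-multiple p s k with p ∣? k * p
  ... | yes (divides k′ eq) = cong s (≡.sym (*-cancelʳ-≡ k k′ p eq))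
  ... | no p∤               = contradiction (divides k refl) p∤

  scale-nonmultiple : ∀ p s d → ¬ p ∣ d → scale p s d ≡ nothing
  scale-nonmultiple p s d p∤d with p ∣? d
  ... | yes p∣d = contradiction p∣d p∤d
  ... | no _    = refl

  -- The exponent of 1 - y^-d in F′ ps y.
  e : List ℕ → ℕ → Maybe Sign
  e []       1 = just Sign.+
  e []       _ = nothing
  -- For p outside `ps` at most one alternative is nonzero, since a nonzero `e ps d` needs d to
  -- divide ∏ ps. So this choice adds the exponents.
  e (p ∷ ps) d = e ps d <∣> Maybe.map opposite (scale p (e ps) d)

  e-∷-just : ∀ p ps d {u} → e (p ∷ ps) d ≡ just u →
             e ps d ≡ just u ⊎ ∃[ k ] ∃[ v ] d ≡ k * p × e ps k ≡ just v × u ≡ opposite v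
  e-∷-just p ps d eq with e ps d | scale p (e ps) d in eq′
  e-∷-just p ps d refl | just _  | _      = inj₁ refl
  e-∷-just p ps d refl | nothing | just v =
    let k , d≡ , ek = scale-just p (e ps) d eq′ in inj₂ (k , v , d≡ , ek , refl)
  e-∷-just p ps d ()   | nothing | nothing

  e-∣ : ∀ ps d {u} → e ps d ≡ just u → d ∣ product ps
  e-∣ []       1 eq = 1∣ 1
  e-∣ []       0 ()
  e-∣ []       (suc (suc _)) ()
  e-∣ (p ∷ ps) d eq with e-∷-just p ps d eq
  ... | inj₁ eq′ = ∣n⇒∣m*n p (e-∣ ps d eq′)
  ... | inj₂ (k , _ , refl , eq′ , _) = subst (k * p ∣_) (*-comm (product ps) p) (*-monoˡ-∣ p (e-∣ ps k eq′))

  e-Liouville : ∀ {ps} → PrimeSet ps → ∀ d {u} → e ps d ≡ just u → Liouville d u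
  e-Liouville [] 1 refl = [] , refl , [] , refl
  e-Liouville [] 0 ()
  e-Liouville [] (suc (suc _)) ()
  e-Liouville {p ∷ ps} (insert pp p∉ S) d eq with e-∷-just p ps d eq
  ... | inj₁ eq′ = e-Liouville S d eq′
  ... | inj₂ (k , v , refl , eq′ , refl) with qs , k≡ , primes , v≡ ← e-Liouville S k eq′ =
    p ∷ qs , ≡.trans (*-comm k p) (cong (p *_) k≡) , pp ∷ primes , cong opposite v≡

  e-cases : ∀ {ps d s} → PrimeSet ps → Liouville d s → e ps d ≡ nothing ⊎ e ps d ≡ just s
  e-cases {ps} {d} S L with e ps d in eq
  ... | nothing = inj₁ refl
  ... | just u  = inj₂ (cong just (Liouville-unique (e-Liouville S d eq) L))

  -- By unique factorisation, nonzero exponents at d are both λ(d), whichever prime sets they come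
  -- from.
  e-compatible : ∀ {ps ps′} → PrimeSet ps → PrimeSet ps′ → ∀ d → Compatible (e ps d) (e ps′ d)
  e-compatible {ps} {ps′} S S′ d with e ps d in eq | e ps′ d in eq′
  ... | nothing | nothing = same
  ... | nothing | just _  = noneˡ
  ... | just _  | nothing = noneʳ
  ... | just u  | just v rewrite Liouville-unique (e-Liouville S d eq) (e-Liouville S′ d eq′) = same

  e-1 : ∀ ps → e ps 1 ≡ just Sign.+
  e-1 []       = refl
  e-1 (p ∷ ps) rewrite e-1 ps = refl

  e-prime : ∀ {ps r} → PrimeSet ps → r ∈ ps → e ps r ≡ just Sign.-
  e-prime {p ∷ ps} (insert pp p∉ S) (here refl) with e-cases {ps} S (Liouville-prime pp)
  ... | inj₂ eq = contradiction (e-∣ ps p eq) (∤product pp p∉ S)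
  ... | inj₁ eq rewrite eq
    | subst (λ m → scale p (e ps) m ≡ e ps 1) (*-identityˡ p) (scale-multiple p {{prime⇒nonZero pp}} (e ps) 1)
    | e-1 ps = refl
  e-prime {p ∷ ps} (insert _ _ S) (there r∈) rewrite e-prime S r∈ = refl

  -- 4 is not squarefree. A factor at d = 4 could cost `even⇒≼F′` a share of 1/256 at y = 4, more
  -- than the margin of `fine-bound₄`.
  e-4 : ∀ {ps} → PrimeSet ps → e ps 4 ≡ nothing
  e-4 [] = refl
  e-4 {p ∷ ps} (insert pp p∉ S) rewrite e-4 S with scale p (e ps) 4 in eq
  ... | nothing = refl
  ... | just u with k , 4≡kp , ek ← scale-just p (e ps) 4 eq
      with refl ← prime∣prime⇒≡ pp prime[2] (Sum.reduce (euclidsLemma 2 2 pp (divides k 4≡kp)))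
      with refl ← *-cancelʳ-≡ 2 k 2 4≡kp = contradiction (e-∣ ps 2 ek) (∤product pp p∉ S)

  prime-divisor : ∀ d → ∃[ p ] Prime p × p ∣ suc (suc d)
  prime-divisor d with factorise (suc (suc d))
  ... | record { factors = p ∷ qs ; isFactorisation = eq ; factorsPrime = pp ∷ _ } =
    p , pp , divides (product qs) (≡.trans eq (*-comm p (product qs)))

  -- The least divisor d > 1 is a prime.
  e-negative-first : ∀ {ps} → PrimeSet ps → ∀ i → e ps (suc (suc i)) ≡ just Sign.+ →
                     ∃[ j ] j < i × e ps (suc (suc j)) ≡ just Sign.-
  e-negative-first {ps} S i eq with prime-divisor i
  ... | zero , pp , _ = contradiction pp ¬prime[0]
  ... | suc zero , pp , _ = contradiction pp ¬prime[1]
  ... | suc (suc j) , pp , r∣d = j , j<i , er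
    where
    er : e ps (suc (suc j)) ≡ just Sign.-
    er = e-prime S (factorisationHasAllPrimeFactors pp (∣-trans r∣d (e-∣ ps _ eq)) (allPrime S))
    j<i : j < i
    j<i with s≤s (s≤s j≤i) ← ∣⇒≤ r∣d = ≤∧≢⇒< j≤i λ {refl → contradiction (≡.trans (≡.sym eq) er) λ ()}

  product≢0 : ∀ {ps} → PrimeSet ps → NonZero (product ps)
  product≢0 S = productOfPrimes≢0 (allPrime S)

  ^ˢ-opposite : ∀ a s → a ^ˢ Maybe.map opposite s ≃ (a ^ˢ s) ⁻¹
  ^ˢ-opposite a (just Sign.+) = Q.refl
  ^ˢ-opposite a (just Sign.-) = Q.sym (Q.⁻¹-involutive a)
  ^ˢ-opposite a nothing       = Q.sym Q.ε⁻¹≈ε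

  ∏-⁻¹ : ∀ n h → Q.∏ n (λ i → h i ⁻¹) ≃ Q.∏ n h ⁻¹
  ∏-⁻¹ zero    h = Q.sym Q.ε⁻¹≈ε
  ∏-⁻¹ (suc n) h = Q.trans (Q.∙-congˡ {h 0 ⁻¹} (∏-⁻¹ n (h ∘ suc))) (Q.⁻¹-∙-comm (h 0) _)

  -- Any positive multiple of ∏ ps serves as range, as exponents vanish off the divisors of ∏ ps.
  -- The free `j` feeds the induction, gives two prime sets a common range, and makes room for
  -- explicit first factors.
  expand : ∀ {ps} → PrimeSet ps → ∀ j .{{_ : NonZero j}} y →
           F′ ps y ≃ weights y ^ˢ[ j * product ps ] (e ps ∘ suc)
  expand [] (suc j) y = Q.sym (begin
    w (y ^ 1) · Q.∏ (j * 1) (λ i → weights y (suc i) ^ˢ e [] (suc (suc i)))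
      ≈⟨ Q.∙-cong (Q.reflexive (cong w (*-identityʳ y))) (Q.∏-ε (j * 1) λ _ _ → Q.refl) ⟩
    w y · 1ℚ ≈⟨ Q.identityʳ (w y) ⟩
    w y ∎)
    where open import Relation.Binary.Reasoning.Setoid Q.setoid
  expand {p ∷ ps} (insert pp p∉ S) j y = Q.sym (begin
    Q.∏ (j * (p * N)) (λ i → weights y i ^ˢ e (p ∷ ps) (suc i))
      ≈⟨ Q.∏-cong′ (j * (p * N)) pointwise ⟩
    Q.∏ (j * (p * N)) (λ i → weights y i ^ˢ e ps (suc i) · multiples i ⁻¹)
      ≈⟨ Q.∏-∙ (j * (p * N)) (λ i → weights y i ^ˢ e ps (suc i)) (λ i → multiples i ⁻¹) ⟩
    Q.∏ (j * (p * N)) (λ i → weights y i ^ˢ e ps (suc i)) · Q.∏ (j * (p * N)) (λ i → multiples i ⁻¹)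
      ≈⟨ Q.∙-cong first (Q.trans (∏-⁻¹ (j * (p * N)) multiples) (Q.⁻¹-cong second)) ⟩
    F′ ps y · F′ ps (y ^ p) ⁻¹ ∎)
    where
    open import Relation.Binary.Reasoning.Setoid Q.setoid
    instance p≢0 = prime⇒nonZero pp
    N = product ps
    multiples : ℕ → ℚ⁺
    multiples i = weights y i ^ˢ scale p (e ps) (suc i)
    pointwise : ∀ i → weights y i ^ˢ e (p ∷ ps) (suc i) ≃ weights y i ^ˢ e ps (suc i) · multiples i ⁻¹
    pointwise i with e ps (suc i) in eq
    ... | nothing = Q.trans (^ˢ-opposite (weights y i) (scale p (e ps) (suc i))) (Q.sym (Q.identityˡ _))
    ... | just u rewrite scale-nonmultiple p (e ps) (suc i)
                           (λ p∣ → ∤product pp p∉ S (∣-trans p∣ (e-∣ ps _ eq)))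
      = Q.sym (Q.trans (Q.∙-congˡ {weights y i ^ˢ just u} Q.ε⁻¹≈ε) (Q.identityʳ (weights y i ^ˢ just u)))
    first : Q.∏ (j * (p * N)) (λ i → weights y i ^ˢ e ps (suc i)) ≃ F′ ps y
    first = begin
      Q.∏ (j * (p * N)) (λ i → weights y i ^ˢ e ps (suc i))
        ≡⟨ cong (λ k → weights y ^ˢ[ k ] (e ps ∘ suc)) (≡.sym (*-assoc j p N)) ⟩
      Q.∏ (j * p * N) (λ i → weights y i ^ˢ e ps (suc i))
        ≈⟨ expand S (j * p) {{m*n≢0 j p}} y ⟨
      F′ ps y ∎
    at-multiple : ∀ i → multiples (pred (suc i * p)) ≡ weights (y ^ p) i ^ˢ e ps (suc i)
    at-multiple i = ≡.trans
      (cong (λ d → w (y ^ d) ^ˢ scale p (e ps) d) (suc-pred (suc i * p) {{m*n≢0 (suc i) p}}))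
      (cong₂ (λ x s → w x ^ˢ s)
        (≡.trans (cong (y ^_) (*-comm (suc i) p)) (≡.sym (^-*-assoc y p (suc i))))
        (scale-multiple p (e ps) (suc i)))
    second : Q.∏ (j * (p * N)) multiples ≃ F′ ps (y ^ p)
    second = begin
      Q.∏ (j * (p * N)) multiples
        ≡⟨ cong (λ k → Q.∏ k multiples) (≡.trans (cong (j *_) (*-comm p N)) (≡.sym (*-assoc j N p))) ⟩
      Q.∏ (j * N * p) multiples
        ≈⟨ Q.∏-multiples p (j * N) multiples (λ i p∤ →
             Q.reflexive (cong (weights y i ^ˢ_) (scale-nonmultiple p (e ps) (suc i) p∤))) ⟩
      Q.∏ (j * N) (λ i → multiples (pred (suc i * p)))
        ≈⟨ Q.∏-cong′ (j * N) (λ i → Q.reflexive (at-multiple i)) ⟩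
      Q.∏ (j * N) (λ i → weights (y ^ p) i ^ˢ e ps (suc i))
        ≈⟨ expand S j (y ^ p) ⟨
      F′ ps (y ^ p) ∎

  -- Bounds on the product from its first factors

  Slow-drop : ∀ i {f} → Slow f → Slow (λ j → f (i + j))
  Slow-drop zero    slow = slow
  Slow-drop (suc i) slow = Slow-drop i (Slow-suc slow)

  ≡⇒≼ : ∀ {a b} → a ≡ b → a ≼ b
  ≡⇒≼ refl = ≼-refl

  module _ {ps} (S : PrimeSet ps) {y} (2≤y : 2 ≤ y) where
    private
      f = weights y
      slow = weights-slow 2≤y
      -- The range 7 ∏ ps is long enough to peel off d = 1, ..., 6 whatever `ps` is.
      k = 7 * product ps ∸ 7
      s : ℕ → Maybe Sign
      s = e ps ∘ suc

    expand₇ : F′ ps y ≃ f 0 · (f ∘ suc ^ˢ[ 6 + k ] s ∘ suc)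
    expand₇ = Q.trans (expand S 7 y) (Q.trans
      (Q.reflexive (cong (λ n → f ^ˢ[ n ] s) (≡.sym (m+[n∸m]≡n (m≤m*n 7 (product ps) {{product≢0 S}})))))
      (Q.∙-congʳ {f ∘ suc ^ˢ[ 6 + k ] s ∘ suc} (Q.reflexive (cong (f 0 ^ˢ_) (e-1 ps)))))

    F′≼1 : F′ ps y ≼ 1ℚ
    F′≼1 = ≼-trans (proj₁ expand₇) (≼-trans (·-monoˡ (f 0) (tail≼ slow (6 + k) (s ∘ suc)))
      (proj₁ (Q.inverseʳ (f 0))))

    -- Past d = 1 the first nonzero exponent is negative, so all those factors together are at least
    -- 1.
    w≼F′ : w y ≼ F′ ps y
    w≼F′ = ≼-trans (proj₁ (Q.trans (Q.reflexive (cong w (≡.sym (*-identityʳ y)))) (Q.sym (Q.identityʳ (f 0)))))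
      (≼-trans (·-monoˡ (f 0) (1≼negative-first (6 + k) (Slow-suc slow) (s ∘ suc) (e-negative-first S)))
        (proj₂ expand₇))

    private
      prime-≼ : ∀ {p} → Prime p → ∀ a → a ≼ 1ℚ → a ^ˢ e ps p ≼ a ⁻¹
      prime-≼ pp a a≼1 with e-cases {ps} S (Liouville-prime pp)
      ... | inj₁ eq rewrite eq = 1≼⁻¹ a≼1
      ... | inj₂ eq rewrite eq = ≼-refl

      1≼prime : ∀ {p} → Prime p → ∀ a → a ≼ 1ℚ → 1ℚ ≼ a ^ˢ e ps p
      1≼prime pp a a≼1 with e-cases {ps} S (Liouville-prime pp)
      ... | inj₁ eq rewrite eq = ≼-refl
      ... | inj₂ eq rewrite eq = 1≼⁻¹ a≼1

      prime[3] : Prime 3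
      prime[3] = toWitness {a? = prime? 3} tt
      prime[5] : Prime 5
      prime[5] = toWitness {a? = prime? 5} tt

      e-6 : ∀ a → a ≼ 1ℚ → a ^ˢ e ps 6 ≼ 1ℚ
      e-6 a a≼1 with e-cases {ps} {6} S (2 ∷ 3 ∷ [] , refl , prime[2] ∷ prime[3] ∷ [] , refl)
      ... | inj₁ eq rewrite eq = ≼-refl
      ... | inj₂ eq rewrite eq = a≼1

      f≼1 : ∀ i → f i ≼ 1ℚ
      f≼1 = Slow.≼1 slow

    -- The exponent at d = 2 is 0 or -1, bounded by one `f 1 ⁻¹`; the other bounds all d ≥ 3
    -- together.
    F′≼coarse : F′ ps y ≼ f 0 · (f 1 ⁻¹ · f 1 ⁻¹)
    F′≼coarse = ≼-trans (proj₁ expand₇) (·-monoˡ (f 0)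
      (·-mono (prime-≼ prime[2] (f 1) (f≼1 1)) (tail≼ (Slow-drop 1 slow) (5 + k) (λ j → s (2 + j)))))

    -- Worst case: exponent -1 at 2, 3, 5, and 0 at 4 and 6. The last `f 5 ⁻¹` is not the factor at
    -- d = 6 but the bound on all d ≥ 7.
    F′≼fine : F′ ps y ≼ f 0 · (f 1 ⁻¹ · (f 2 ⁻¹ · (1ℚ · (f 4 ⁻¹ · (1ℚ · f 5 ⁻¹)))))
    F′≼fine = ≼-trans (proj₁ expand₇) (·-monoˡ (f 0)
      (·-mono (prime-≼ prime[2] (f 1) (f≼1 1))
      (·-mono (prime-≼ prime[3] (f 2) (f≼1 2))
      (·-mono (≡⇒≼ (cong (f 3 ^ˢ_) (e-4 S)))
      (·-mono (prime-≼ prime[5] (f 4) (f≼1 4))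
      (·-mono (e-6 (f 5) (f≼1 5))
        (tail≼ (Slow-drop 5 slow) (1 + k) (λ j → s (6 + j)))))))))

    -- The factor at d = 2 is known exactly, those at 3 and 5 are at least 1, and `f 4` bounds all d
    -- ≥ 6 from below.
    even⇒≼F′ : 2 ∈ ps → f 0 · (f 1 ⁻¹ · (1ℚ · (1ℚ · (1ℚ · f 4)))) ≼ F′ ps y
    even⇒≼F′ 2∈ = ≼-trans (·-monoˡ (f 0)
      (·-mono (≡⇒≼ (cong (f 1 ^ˢ_) (≡.sym (e-prime S 2∈))))
      (·-mono (1≼prime prime[3] (f 2) (f≼1 2))
      (·-mono (≡⇒≼ (cong (f 3 ^ˢ_) (≡.sym (e-4 S))))
      (·-mono (1≼prime prime[5] (f 4) (f≼1 4))
        (tail≽ (Slow-drop 4 slow) (2 + k) (λ j → s (5 + j)))))))) (proj₂ expand₇)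

  opaque
    unfolding _·_ _⁻¹

    coarse-bound : ∀ l → let f = weights (4 + l) in f 0 · (f 1 ⁻¹ · f 1 ⁻¹) ≼ w (2 * (4 + l))
    -- With Q = 4 + l the difference of the cross products is Q (Q - 1) (Q³ - 3Q² - Q + 1).
    coarse-bound l = cross (≤-trans (m≤m+n _ ((4 + l) * (3 + l) * (l * l * l + 9 * (l * l) + 23 * l + 13)))
      (≤-reflexive (eq l)))
      where
      eq : ∀ l → let x = suc (suc (suc (suc (l * 1))))
                     c = suc (suc (l * 1)) + (3 + l) * x
                     d = suc (suc l) + suc (suc (suc (suc (l + 0)))) in
           suc (suc (suc (l * 1))) * (suc (suc c) * suc (suc c)) * suc (suc d) +
           (4 + l) * (3 + l) * (l * l * l + 9 * (l * l) + 23 * l + 13) ≡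
           suc d * (suc (suc (suc (suc (l * 1)))) * (suc c * suc c))
      eq = solve-∀

    -- The left side is 27/32, above w 6 = 5/6, so doubling the argument is not enough here; but the
    -- next power of 3 is 9.
    coarse-bound₃ : let f = weights 3 in f 0 · (f 1 ⁻¹ · f 1 ⁻¹) ≼ w 9
    coarse-bound₃ = cross (≤ᵇ⇒≤ _ _ tt)

    -- The coarse bound at y = 2 is 8/9, too large for w 8 = 7/8.
    fine-bound : let f = weights 2 in f 0 · (f 1 ⁻¹ · (f 2 ⁻¹ · (1ℚ · (f 4 ⁻¹ · (1ℚ · f 5 ⁻¹))))) ≼ w 8
    fine-bound = cross (≤ᵇ⇒≤ _ _ tt)

    -- 0.7990 ≤ 0.7992
    fine-bound₄ : let f = weights 2 ; g = weights 4 in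
      f 0 · (f 1 ⁻¹ · (f 2 ⁻¹ · (1ℚ · (f 4 ⁻¹ · (1ℚ · f 5 ⁻¹))))) ≼ g 0 · (g 1 ⁻¹ · (1ℚ · (1ℚ · (1ℚ · g 4))))
    fine-bound₄ = cross (≤ᵇ⇒≤ _ _ tt)

  -- Comparison at different scales

  -- The larger argument is at least twice the smaller one, Q, and for Q ≥ 4 the coarse bound then
  -- suffices. This leaves q = 2 and q = 3 with t = 1. For q = 2 and t′ = 2 the lower bound w 4 =
  -- 3/4 is too weak, and the factor at d = 2 is needed, whence `even`.
  F′-scale : ∀ {ps ps′} → PrimeSet ps → PrimeSet ps′ → ∀ {t t′} → 0 < t → t < t′ → (t′ ≡ 2 → 2 ∈ ps′) →
             ∀ q → 2 ≤ q → F′ ps (q ^ t) ≼ F′ ps′ (q ^ t′)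
  F′-scale {ps} {ps′} S S′ {t} {t′} 0<t t<t′ even q 2≤q = go q t 2≤q 0<t t<t′
    where
    far : ∀ Q Z → 4 ≤ Q → 2 * Q ≤ Z → F′ ps Q ≼ F′ ps′ Z
    far Q@(suc (suc (suc (suc l)))) Z (s≤s (s≤s (s≤s (s≤s z≤n)))) 2Q≤Z =
      ≼-trans (F′≼coarse S (s≤s (s≤s z≤n))) (≼-trans (coarse-bound l)
        (≼-trans (w-mono 2Q≤Z) (w≼F′ S′ (≤-trans (≤-trans (s≤s (s≤s z≤n)) (m≤n*m Q 2)) 2Q≤Z))))
    2Q≤Z : ∀ {q t} → 2 ≤ q → t < t′ → 2 * q ^ t ≤ q ^ t′
    2Q≤Z {q} {t} 2≤q t<t′ = ≤-trans (*-monoˡ-≤ (q ^ t) 2≤q) (^-monoʳ-≤ q t<t′)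
      where instance _ = >-nonZero (<-≤-trans z<s 2≤q)
    near : ∀ t′ → 1 < t′ → (t′ ≡ 2 → 2 ∈ ps′) → F′ ps 2 ≼ F′ ps′ (2 ^ t′)
    near 1 (s≤s ())
    near 2 _ even = ≼-trans (F′≼fine S ≤-refl) (≼-trans fine-bound₄ (even⇒≼F′ S′ (s≤s (s≤s z≤n)) (even refl)))
    near t′@(suc (suc (suc r))) _ _ = ≼-trans (F′≼fine S ≤-refl) (≼-trans fine-bound
      (≼-trans (w-mono 8≤) (w≼F′ S′ (≤-trans (s≤s (s≤s z≤n)) 8≤))))
      where
      8≤ : 8 ≤ 2 ^ t′
      8≤ = ^-monoʳ-≤ 2 {3} {t′} (s≤s (s≤s (s≤s z≤n)))
    near₃ : ∀ t′ → 1 < t′ → F′ ps 3 ≼ F′ ps′ (3 ^ t′)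
    near₃ t′ 1<t′ = ≼-trans (F′≼coarse S (s≤s (s≤s z≤n))) (≼-trans coarse-bound₃
      (≼-trans (w-mono 9≤) (w≼F′ S′ (≤-trans (s≤s (s≤s z≤n)) 9≤))))
      where
      9≤ : 9 ≤ 3 ^ t′
      9≤ = ^-monoʳ-≤ 3 {2} {t′} 1<t′
    go : ∀ q t → 2 ≤ q → 0 < t → t < t′ → F′ ps (q ^ t) ≼ F′ ps′ (q ^ t′)
    go 1 _ (s≤s ())
    go 2 1 _ _ 1<t′ = near t′ 1<t′ even
    go 3 1 _ _ 1<t′ = near₃ t′ 1<t′
    go q@(suc (suc (suc (suc l)))) t@(suc t-1) 2≤q _ t<t′ =
      far (q ^ t) (q ^ t′) (≤-trans (s≤s (s≤s (s≤s (s≤s z≤n)))) (x≤x^ q t)) (2Q≤Z 2≤q t<t′)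
    go q t@(suc (suc r)) 2≤q _ t<t′ = far (q ^ t) (q ^ t′) 4≤ (2Q≤Z 2≤q t<t′)
      where
      4≤ : 4 ≤ q ^ t
      4≤ = ≤-trans (^-monoʳ-≤ 2 {2} {t} (s≤s (s≤s z≤n))) (^-monoˡ-≤ t 2≤q)

  module _ (A B : ℕ → ℚ⁺) (A≼1 : ∀ q → 2 ≤ q → A q ≼ 1ℚ) (B≼1 : ∀ q → 2 ≤ q → B q ≼ 1ℚ) where

    signed : (∀ q → 2 ≤ q → A q ≼ B q) ⊎ (∀ q → 2 ≤ q → B q ≼ A q) → ∀ s s′ →
             (∀ q → 2 ≤ q → A q ^ˢ just s ≼ B q ^ˢ just s′) ⊎ (∀ q → 2 ≤ q → B q ^ˢ just s′ ≼ A q ^ˢ just s)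
    signed A?B      Sign.+ Sign.+ = A?B
    signed (inj₁ h) Sign.- Sign.- = inj₂ λ q 2≤q → ⁻¹-anti (h q 2≤q)
    signed (inj₂ h) Sign.- Sign.- = inj₁ λ q 2≤q → ⁻¹-anti (h q 2≤q)
    signed _        Sign.+ Sign.- = inj₁ λ q 2≤q → ≼-trans (A≼1 q 2≤q) (1≼⁻¹ (B≼1 q 2≤q))
    signed _        Sign.- Sign.+ = inj₂ λ q 2≤q → ≼-trans (B≼1 q 2≤q) (1≼⁻¹ (A≼1 q 2≤q))

  shape⇒primeSet : ∀ {n t ps} → Shape n t ps → PrimeSet ps
  shape⇒primeSet unit           = []
  shape⇒primeSet (old _ _ s)    = shape⇒primeSet s
  shape⇒primeSet (new pp p∉ s)  = insert pp p∉ (shape⇒primeSet s)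

  shape⇒0<t : ∀ {n t ps} → Shape n t ps → 0 < t
  shape⇒0<t unit = z<s
  shape⇒0<t (old {p} {t = t} pp _ s) = >-nonZero⁻¹ (p * t)
    {{m*n≢0 p t {{prime⇒nonZero pp}} {{>-nonZero (shape⇒0<t s)}}}}
  shape⇒0<t (new _ _ s) = shape⇒0<t s

  -- The scale grows only in `old` steps, by primes already in `ps`.
  shape-scale-even : ∀ {n t ps} → Shape n t ps → t ≡ 2 → 2 ∈ ps
  shape-scale-even (old {p} {t = t} pp p∈ s) pt≡2 =
    subst (_∈ _) (prime∣prime⇒≡ pp prime[2] (divides t (≡.trans (≡.sym pt≡2) (*-comm p t)))) p∈
  shape-scale-even (new pp p∉ s) t≡2 = there (shape-scale-even s t≡2)

  2≤q^ : ∀ {q t} → 2 ≤ q → 0 < t → 2 ≤ q ^ t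
  2≤q^ {q} {t} 2≤q 0<t = ≤-trans 2≤q (x≤x^ q t)
    where instance _ = >-nonZero (<-≤-trans z<s 2≤q)
                   _ = >-nonZero 0<t

  module _ {n t ps} (s : Shape n t ps) {n′ t′ ps′} (s′ : Shape n′ t′ ps′) where
    private
      S = shape⇒primeSet s
      S′ = shape⇒primeSet s′

    F′-total : (∀ q → 2 ≤ q → F′ ps (q ^ t) ≼ F′ ps′ (q ^ t′)) ⊎
               (∀ q → 2 ≤ q → F′ ps′ (q ^ t′) ≼ F′ ps (q ^ t))
    F′-total with <-cmp t t′
    ... | tri< t<t′ _ _ = inj₁ (F′-scale S S′ (shape⇒0<t s) t<t′ (shape-scale-even s′))
    ... | tri> _ _ t′<t = inj₂ (F′-scale S′ S (shape⇒0<t s′) t′<t (shape-scale-even s))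
    ... | tri≈ _ refl _ = Sum.map
            (λ h q 2≤q → ≼-trans (proj₁ (ps≃ q))
              (≼-trans (h (weights-slow (2≤q^ 2≤q (shape⇒0<t s)))) (proj₂ (ps′≃ q))))
            (λ h q 2≤q → ≼-trans (proj₁ (ps′≃ q))
              (≼-trans (h (weights-slow (2≤q^ 2≤q (shape⇒0<t s)))) (proj₂ (ps≃ q))))
            (first-difference N (e ps ∘ suc) (e ps′ ∘ suc) (e-compatible S S′ ∘ suc))
      where
      N = product ps′ * product ps
      ps≃ : ∀ q → F′ ps (q ^ t) ≃ weights (q ^ t) ^ˢ[ N ] (e ps ∘ suc)
      ps≃ q = expand S (product ps′) {{product≢0 S′}} (q ^ t)
      ps′≃ : ∀ q → F′ ps′ (q ^ t) ≃ weights (q ^ t) ^ˢ[ N ] (e ps′ ∘ suc)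
      ps′≃ q = Q.trans (expand S′ (product ps) {{product≢0 S}} (q ^ t))
        (Q.reflexive (cong (λ k → weights (q ^ t) ^ˢ[ k ] (e ps′ ∘ suc)) (*-comm (product ps) (product ps′))))

    F-total : (∀ q → 2 ≤ q → F ps (q ^ t) ≼ F ps′ (q ^ t′)) ⊎
              (∀ q → 2 ≤ q → F ps′ (q ^ t′) ≼ F ps (q ^ t))
    F-total = signed (λ q → F′ ps (q ^ t)) (λ q → F′ ps′ (q ^ t′))
      (λ q 2≤q → F′≼1 S (2≤q^ 2≤q (shape⇒0<t s))) (λ q 2≤q → F′≼1 S′ (2≤q^ 2≤q (shape⇒0<t s′)))
      F′-total (sign ps) (sign ps′)

  -- Comparison of values

  ⟦⟧-mono : ∀ {m n} → m ≤ n → ⟦ m ⟧ ≼ ⟦ n ⟧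
  ⟦⟧-mono m≤n = cross (*-monoˡ-≤ 1 (s≤s (∸-monoˡ-≤ 1 m≤n)))

  ⟦⟧-cancel : ∀ {m n} .{{_ : NonZero m}} .{{_ : NonZero n}} → ⟦ m ⟧ ≼ ⟦ n ⟧ → m ≤ n
  ⟦⟧-cancel {suc m} {suc n} (cross p) = *-cancelʳ-≤ (suc m) (suc n) 1 p

  module _ {n t ps} (s : Shape n t ps) where
    private
      S = shape⇒primeSet s
      D = t * φ ps

    module _ {q} (2≤q : 2 ≤ q) where
      private
        instance
          q≢0 = >-nonZero (<-≤-trans z<s 2≤q)
          t≢0 = >-nonZero (shape⇒0<t s)
        2≤Q = 2≤q^ {t = t} 2≤q (shape⇒0<t s)

        w≼F′-q : w q ≼ F′ ps (q ^ t)
        w≼F′-q = ≼-trans (w-mono (x≤x^ q t)) (w≼F′ S 2≤Q)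

      shape-value : ∀ {V} → Quotient ps (q ^ t) V → NonZero V × ⟦ V ⟧ ≃ ⟦ q ^ D ⟧ · F ps (q ^ t)
      shape-value {V} quot with V≢0 , eq ← value (allPrime S) 2≤Q quot =
        V≢0 , Q.trans eq (Q.∙-congʳ {F ps (q ^ t)} (Q.reflexive (cong ⟦_⟧ (^-*-assoc q t (φ ps)))))

      w≼F : w q ≼ F ps (q ^ t)
      w≼F with sign ps
      ... | Sign.+ = w≼F′-q
      ... | Sign.- = ≼-trans (w≼1 q) (1≼⁻¹ (F′≼1 S 2≤Q))

      F≼w⁻¹ : F ps (q ^ t) ≼ w q ⁻¹
      F≼w⁻¹ with sign ps
      ... | Sign.+ = ≼-trans (F′≼1 S 2≤Q) (1≼⁻¹ (w≼1 q))
      ... | Sign.- = ⁻¹-anti w≼F′-q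

  opaque
    unfolding _·_ _⁻¹
    -- Amounts to 1 ≤ (q - 1)², an equality at q = 2. With a single factor q it would be q ≤ (q -
    -- 1)², false at q = 2; so a degree gap of 1 needs its own argument.
    w⁻¹≼q²w : ∀ {q} → 2 ≤ q → w q ⁻¹ ≼ ⟦ q ⟧ · ⟦ q ⟧ · w q
    w⁻¹≼q²w {suc (suc a)} (s≤s (s≤s z≤n)) =
      cross (≤-trans (m≤m+n _ (a * (a + 2) * (a + 2) * (a + 2))) (≤-reflexive (eq a)))
      where
      eq : ∀ a → suc (suc a) * (1 * suc (suc a)) + a * (a + 2) * (a + 2) * (a + 2) ≡
                 suc (suc a) * suc (suc a) * suc a * suc a
      eq = solve-∀

  φ≢0 : ∀ {ps} → All Prime ps → NonZero (φ ps)
  φ≢0 []                  = _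
  φ≢0 {p ∷ ps} (pp ∷ primes) = m*n≢0 (p ∸ 1) (φ ps) {{>-nonZero (m<n⇒0<n∸m (prime⇒1< pp))}} {{φ≢0 primes}}
    where
    prime⇒1< : ∀ {p} → Prime p → 1 < p
    prime⇒1< pp = nonTrivial⇒n>1 _ {{prime⇒nonTrivial pp}}

  degree : ∀ {n t ps} → Shape n t ps → ℕ
  degree {t = t} {ps} _ = t * φ ps

  0<degree : ∀ {n t ps} (s : Shape n t ps) → 0 < degree s
  0<degree {t = t} {ps} s = >-nonZero⁻¹ (t * φ ps)
    {{m*n≢0 t (φ ps) {{>-nonZero (shape⇒0<t s)}} {{φ≢0 (allPrime (shape⇒primeSet s))}}}}

  even-pred : ∀ p → 2 ∣ p ⊎ 2 ∣ p ∸ 1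
  even-pred zero          = inj₁ (2 ∣0)
  even-pred (suc zero)    = inj₂ (2 ∣0)
  even-pred (suc (suc p)) with even-pred p
  ... | inj₁ 2∣p = inj₁ (∣m∣n⇒∣m+n (∣-refl {2}) 2∣p)
  even-pred (suc (suc zero))    | inj₂ _   = inj₁ (∣-refl {2})
  even-pred (suc (suc (suc p))) | inj₂ 2∣p = inj₂ (∣m∣n⇒∣m+n (∣-refl {2}) 2∣p)

  degree-even : ∀ {n t ps} (s : Shape n t ps) → 2 ∣ degree s ⊎ (t ≡ 1 × (ps ≡ [] ⊎ ps ≡ 2 ∷ []))
  degree-even unit = inj₂ (refl , inj₁ refl)
  degree-even (old {p} {t = t} {ps} pp p∈ s) with degree-even s
  ... | inj₁ 2∣D = inj₁ (subst (2 ∣_) (≡.sym (*-assoc p t (φ ps))) (∣n⇒∣m*n p 2∣D))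
  degree-even (old pp () s)          | inj₂ (refl , inj₁ refl)
  degree-even (old pp (here refl) s) | inj₂ (refl , inj₂ refl) = inj₁ (divides 1 refl)
  degree-even (new {p} {t = t} {ps} pp p∉ s) with degree-even s | even-pred p
  ... | inj₁ 2∣D | _ = inj₁ (subst (2 ∣_) (shuffle t (p ∸ 1) (φ ps)) (∣n⇒∣m*n (p ∸ 1) 2∣D))
    where
    shuffle : ∀ a b c → b * (a * c) ≡ a * (b * c)
    shuffle = solve-∀
  ... | inj₂ _ | inj₂ 2∣p-1 = inj₁ (∣n⇒∣m*n t (∣m⇒∣m*n (φ ps) 2∣p-1))
  ... | inj₂ (refl , which) | inj₁ 2∣p with refl ← prime∣prime⇒≡ prime[2] pp 2∣p | which
  ...   | inj₁ refl = inj₂ (refl , inj₂ refl)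
  ...   | inj₂ refl = contradiction (here refl) p∉

  Φ≤ : ∀ {n t ps n′ t′ ps′} → Shape n t ps → Shape n′ t′ ps′ → Set
  Φ≤ {t = t} {ps} {t′ = t′} {ps′} _ _ =
    ∀ q → 2 ≤ q → ∀ {V V′} → Quotient ps (q ^ t) V → Quotient ps′ (q ^ t′) V′ → V ≤ V′

  module _ {n t ps} (s : Shape n t ps) {n′ t′ ps′} (s′ : Shape n′ t′ ps′) where

    Φ≤-from-F : (∀ q → 2 ≤ q → ⟦ q ^ degree s ⟧ · F ps (q ^ t) ≼ ⟦ q ^ degree s′ ⟧ · F ps′ (q ^ t′)) → Φ≤ s s′
    Φ≤-from-F h q 2≤q quot quot′ =
      let V≢0  , eq  = shape-value s 2≤q quot
          V′≢0 , eq′ = shape-value s′ 2≤q quot′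
      in ⟦⟧-cancel {{V≢0}} {{V′≢0}} (≼-trans (proj₁ eq) (≼-trans (h q 2≤q) (proj₂ eq′)))

    Φ≤-equal-degree : degree s ≡ degree s′ → (∀ q → 2 ≤ q → F ps (q ^ t) ≼ F ps′ (q ^ t′)) → Φ≤ s s′
    Φ≤-equal-degree D≡D′ h = Φ≤-from-F λ q 2≤q →
      subst (λ D → ⟦ q ^ degree s ⟧ · F ps (q ^ t) ≼ ⟦ q ^ D ⟧ · F ps′ (q ^ t′)) D≡D′
        (·-monoˡ ⟦ q ^ degree s ⟧ (h q 2≤q))

    Φ≤-far-degree : 2 + degree s ≤ degree s′ → Φ≤ s s′
    Φ≤-far-degree D+2≤D′ = Φ≤-from-F λ q 2≤q →
      let instance q≢0 = >-nonZero (<-≤-trans z<s 2≤q)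
          D = degree s ; D′ = degree s′
          a = ⟦ q ^ D ⟧ ; b = ⟦ q ⟧
          q^2+D : b · b · a ≼ ⟦ q ^ D′ ⟧
          q^2+D = ≼-trans (proj₁ (Q.assoc b b a))
            (≼-trans (·-monoˡ b (proj₂ (⟦⟧-* q (q ^ D) {{q≢0}} {{m^n≢0 q D}})))
            (≼-trans (proj₂ (⟦⟧-* q (q ^ suc D) {{q≢0}} {{m^n≢0 q (suc D)}})) (⟦⟧-mono (^-monoʳ-≤ q D+2≤D′))))
      in ≼-trans (·-monoˡ a (F≼w⁻¹ s 2≤q)) (≼-trans (·-monoˡ a (w⁻¹≼q²w 2≤q))
        (≼-trans (proj₂ (Q.assoc a (b · b) (w q)))
          (·-mono (≼-trans (proj₁ (Q.comm a (b · b))) q^2+D) (w≼F s′ 2≤q))))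

  -- Degrees 1 and 2

  quotient-[2] : ∀ {y V} → 2 ≤ y → Quotient (2 ∷ []) y V → V ≡ 1 + y
  quotient-[2] {suc (suc a)} {V} (s≤s (s≤s z≤n)) (step (base refl) (base eqB) VA≡B) =
    *-cancelʳ-≡ V (3 + a) (suc a) (≡.trans VA≡B (suc-injective (≡.trans eqB (power a))))
    where
    power : ∀ a → (2 + a) * ((2 + a) * 1) ≡ suc ((3 + a) * suc a)
    power = solve-∀

  quotient-[3] : ∀ {y V} → 2 ≤ y → Quotient (3 ∷ []) y V → V ≡ 1 + y + y * y
  quotient-[3] {y@(suc (suc a))} {V} (s≤s (s≤s z≤n)) (step (base refl) (base eqB) VA≡B) =
    *-cancelʳ-≡ V (1 + y + y * y) (suc a) (≡.trans VA≡B (suc-injective (≡.trans eqB (power a))))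
    where
    power : ∀ a → (2 + a) * ((2 + a) * ((2 + a) * 1)) ≡ suc ((1 + (2 + a) + (2 + a) * (2 + a)) * suc a)
    power = solve-∀

  -- Φ₆(y) = y² - y + 1, which is (1 + y) + (a² + 2a) at y = 2 + a. The bound is attained: Φ₆(2) = 3
  -- = Φ₂(2). As `ps` is an ordered list, Φ₆ also occurs as 3 ∷ 2 ∷ [].
  quotient-[2,3] : ∀ {y V} → 2 ≤ y → Quotient (2 ∷ 3 ∷ []) y V → 1 + y ≤ V
  quotient-[2,3] {y@(suc (suc a))} {V} 2≤y@(s≤s (s≤s z≤n)) (step {A = A} {B} quotA quotB VA≡B) =
    ≤-trans (m≤m+n (3 + a) (a * a + 2 * a)) (≤-reflexive (≡.sym
      (*-cancelʳ-≡ V (3 + a + (a * a + 2 * a)) (1 + y + y * y)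
        (≡.trans (cong (V *_) (≡.sym (quotient-[3] 2≤y quotA)))
        (≡.trans VA≡B (≡.trans (quotient-[3] (2≤q^ {t = 2} 2≤y z<s) quotB) (power a)))))))
    where
    power : ∀ a → let y = 2 + a ; z = y * (y * 1) in
            1 + z + z * z ≡ (3 + a + (a * a + 2 * a)) * (1 + y + y * y)
    power = solve-∀

  quotient-[3,2] : ∀ {y V} → 2 ≤ y → Quotient (3 ∷ 2 ∷ []) y V → 1 + y ≤ V
  quotient-[3,2] {y@(suc (suc a))} {V} 2≤y@(s≤s (s≤s z≤n)) (step {A = A} {B} quotA quotB VA≡B) =
    ≤-trans (m≤m+n (3 + a) (a * a + 2 * a)) (≤-reflexive (≡.sym
      (*-cancelʳ-≡ V (3 + a + (a * a + 2 * a)) (1 + y)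
        (≡.trans (cong (V *_) (≡.sym (quotient-[2] 2≤y quotA)))
        (≡.trans VA≡B (≡.trans (quotient-[2] (2≤q^ {t = 3} 2≤y z<s) quotB) (power a)))))))
    where
    power : ∀ a → let y = 2 + a in 1 + y * (y * (y * 1)) ≡ (3 + a + (a * a + 2 * a)) * (1 + y)
    power = solve-∀

  quotient-degree-1 : ∀ {q ps V} → 2 ≤ q → ps ≡ [] ⊎ ps ≡ 2 ∷ [] → Quotient ps (q ^ 1) V → V ≤ 1 + q
  quotient-degree-1 {q} 2≤q (inj₁ refl) (base eq) =
    ≤-trans (n≤1+n _) (≤-trans (≤-reflexive (≡.trans eq (*-identityʳ q))) (n≤1+n q))
  quotient-degree-1 {q} 2≤q (inj₂ refl) quot =
    ≤-reflexive (≡.trans (quotient-[2] (2≤q^ {t = 1} 2≤q z<s) quot) (cong suc (*-identityʳ q)))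

  -- Each p - 1 divides 2, so p is 2 or 3; the positive sign asks for an even number of primes.
  totient-2-primes : ∀ {ps} → PrimeSet ps → φ ps ≡ 2 → sign ps ≡ Sign.+ → ps ≡ 2 ∷ 3 ∷ [] ⊎ ps ≡ 3 ∷ 2 ∷ []
  totient-2-primes {ps} S φ≡2 = classify S (All.tabulate (λ {p} p∈ →
      2or3 p (All.lookup (allPrime S) p∈) (subst (p ∸ 1 ∣_) φ≡2 (p-1∣φ ps p∈)))) φ≡2
    where
    p-1∣φ : ∀ ps {p} → p ∈ ps → p ∸ 1 ∣ φ ps
    p-1∣φ (p ∷ ps) (here refl) = m∣m*n (φ ps)
    p-1∣φ (p ∷ ps) (there p∈)  = ∣n⇒∣m*n (p ∸ 1) (p-1∣φ ps p∈)
    2or3 : ∀ p → Prime p → p ∸ 1 ∣ 2 → p ≡ 2 ⊎ p ≡ 3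
    2or3 0 pp _ = contradiction pp ¬prime[0]
    2or3 1 pp _ = contradiction pp ¬prime[1]
    2or3 2 _ _  = inj₁ refl
    2or3 3 _ _  = inj₂ refl
    2or3 (suc (suc (suc (suc p)))) _ d = contradiction d (>⇒∤ (s≤s (s≤s (s≤s z≤n))))
    classify : ∀ {ps} → PrimeSet ps → All (λ p → p ≡ 2 ⊎ p ≡ 3) ps → φ ps ≡ 2 → sign ps ≡ Sign.+ →
               ps ≡ 2 ∷ 3 ∷ [] ⊎ ps ≡ 3 ∷ 2 ∷ []
    classify [] _ () _
    classify (insert _ _ []) _ _ ()
    classify (insert _ p∉ (insert _ _ [])) (inj₁ refl ∷ inj₁ refl ∷ []) _ _ = contradiction (here refl) p∉
    classify (insert _ p∉ (insert _ _ [])) (inj₂ refl ∷ inj₂ refl ∷ []) _ _ = contradiction (here refl) p∉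
    classify (insert _ _ (insert _ _ [])) (inj₁ refl ∷ inj₂ refl ∷ []) _ _ = inj₁ refl
    classify (insert _ _ (insert _ _ [])) (inj₂ refl ∷ inj₁ refl ∷ []) _ _ = inj₂ refl
    classify (insert _ p∉ (insert _ q∉ (insert _ _ _))) (p≡ ∷ q≡ ∷ r≡ ∷ _) _ _ with p≡ | q≡ | r≡
    ... | inj₁ refl | inj₁ refl | _         = contradiction (here refl) p∉
    ... | inj₂ refl | inj₂ refl | _         = contradiction (here refl) p∉
    ... | inj₁ refl | _         | inj₁ refl = contradiction (there (here refl)) p∉
    ... | inj₂ refl | _         | inj₂ refl = contradiction (there (here refl)) p∉
    ... | _         | inj₁ refl | inj₁ refl = contradiction (here refl) q∉
    ... | _         | inj₂ refl | inj₂ refl = contradiction (here refl) q∉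

  module _ {n t ps} (s : Shape n t ps) (D≡2 : degree s ≡ 2) {q} (2≤q : 2 ≤ q)
           {V} (quot : Quotient ps (q ^ t) V) where
    private
      S = shape⇒primeSet s
      V≢0 = proj₁ (shape-value s 2≤q quot)
      instance
        q≢0 = >-nonZero (<-≤-trans z<s 2≤q)
        q²≢0 = m^n≢0 q 2

      q+2≤q² : 2 + q ≤ q ^ 2
      q+2≤q² = ≤-trans (+-monoˡ-≤ q 2≤q) (≤-trans (≤-reflexive (double q)) (*-monoˡ-≤ (q * 1) 2≤q))
        where
        double : ∀ q → q + q ≡ 2 * (q * 1)
        double = solve-∀

      q²F≼V : ⟦ q ^ 2 ⟧ · F ps (q ^ t) ≼ ⟦ V ⟧
      q²F≼V = subst (λ D → ⟦ q ^ D ⟧ · F ps (q ^ t) ≼ ⟦ V ⟧) D≡2 (proj₂ (proj₂ (shape-value s 2≤q quot)))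

      w≼F⇒ : w (q ^ 2) ≼ F ps (q ^ t) → 1 + q ≤ V
      w≼F⇒ w≼F = ≤-trans (∸-monoˡ-≤ 1 q+2≤q²) (⟦⟧-cancel {pred (q ^ 2)} {V} {{q²-1≢0}} {{V≢0}} (≼-trans
          (subst (λ m → ⟦ pred (q ^ 2) ⟧ ≼ ⟦ m ⟧ · w m) (suc-pred (q ^ 2))
            (proj₁ (⟦⟧-w {pred (q ^ 2)} {{q²-1≢0}})))
          (≼-trans (·-monoˡ ⟦ q ^ 2 ⟧ w≼F) q²F≼V)))
        where
        q²-1≢0 : NonZero (pred (q ^ 2))
        q²-1≢0 = >-nonZero (≤-trans z<s (∸-monoˡ-≤ 1 q+2≤q²))

    -- From V = q² F, the bound F ≥ 1 - 1/q² gives V ≥ q² - 1 ≥ q + 1. It holds when the sign is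
    -- negative or t ≥ 2. What remains is Φ₆, evaluated directly.
    value-degree-2 : 1 + q ≤ V
    value-degree-2 = go (sign ps) refl t refl
      where
      by-list : ∀ {ps} → ps ≡ 2 ∷ 3 ∷ [] ⊎ ps ≡ 3 ∷ 2 ∷ [] → Quotient ps (q ^ 1) V → 1 + q ^ 1 ≤ V
      by-list (inj₁ refl) = quotient-[2,3] (2≤q^ {t = 1} 2≤q z<s)
      by-list (inj₂ refl) = quotient-[3,2] (2≤q^ {t = 1} 2≤q z<s)
      go : ∀ u → sign ps ≡ u → ∀ r → t ≡ r → 1 + q ≤ V
      go Sign.- sgn _ t≡ = w≼F⇒ (≼-trans (w≼1 (q ^ 2)) (subst (λ u → 1ℚ ≼ F′ ps (q ^ t) ^ˢ just u) (≡.sym sgn)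
                         (1≼⁻¹ (F′≼1 S (2≤q^ 2≤q (shape⇒0<t s))))))
      go Sign.+ sgn (suc (suc r)) t≡ = w≼F⇒ (subst (λ u → w (q ^ 2) ≼ F′ ps (q ^ t) ^ˢ just u) (≡.sym sgn)
          (≼-trans (w-mono (^-monoʳ-≤ q (≤-trans (s≤s (s≤s z≤n)) (≤-reflexive (≡.sym t≡)))))
                   (w≼F′ S (2≤q^ 2≤q (shape⇒0<t s)))))
      go Sign.+ sgn zero t≡ = contradiction (≡.sym t≡) (<⇒≢ (shape⇒0<t s))
      go Sign.+ sgn (suc zero) t≡ = subst (λ m → 1 + m ≤ V) (*-identityʳ q) (by-list
          (totient-2-primes S (≡.trans (≡.sym (*-identityˡ (φ ps)))
            (≡.trans (cong (_* φ ps) (≡.sym t≡)) D≡2)) sgn)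
          (subst (λ u → Quotient ps (q ^ u) V) t≡ quot))

  module _ {n t ps} (s : Shape n t ps) {n′ t′ ps′} (s′ : Shape n′ t′ ps′) where

    Φ≤-near-degree : 1 + degree s ≡ degree s′ → Φ≤ s s′
    Φ≤-near-degree D+1≡D′ with degree-even s | degree-even s′
    ... | inj₁ 2∣D | inj₁ 2∣D′ = contradiction
          (∣m+n∣m⇒∣n (subst (2 ∣_) (≡.trans (≡.sym D+1≡D′) (+-comm 1 _)) 2∣D′) 2∣D)
                                   (>⇒∤ (s≤s (s≤s z≤n)))
    -- An exceptional `s′` has degree 1, which would leave degree 0 for `s`.
    ... | _ | inj₂ (refl , inj₁ refl) = contradiction (suc-injective D+1≡D′) (>⇒≢ (0<degree s))
    ... | _ | inj₂ (refl , inj₂ refl) = contradiction (suc-injective D+1≡D′) (>⇒≢ (0<degree s))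
    ... | inj₂ (refl , which) | inj₁ _ = λ q 2≤q quot quot′ →
      ≤-trans (quotient-degree-1 2≤q which quot)
        (value-degree-2 s′ (≡.trans (≡.sym D+1≡D′) (cong suc (degree-1 which))) 2≤q quot′)
      where
      degree-1 : ∀ {ps} → ps ≡ [] ⊎ ps ≡ 2 ∷ [] → 1 * φ ps ≡ 1
      degree-1 (inj₁ refl) = refl
      degree-1 (inj₂ refl) = refl

    Φ≤-smaller-degree : degree s < degree s′ → Φ≤ s s′
    Φ≤-smaller-degree D<D′ with m≤n⇒m<n∨m≡n D<D′
    ... | inj₁ D+1<D′ = Φ≤-far-degree s s′ D+1<D′
    ... | inj₂ D+1≡D′ = Φ≤-near-degree D+1≡D′

  Φ-total : ∀ {n t ps} (s : Shape n t ps) {n′ t′ ps′} (s′ : Shape n′ t′ ps′) → Φ≤ s s′ ⊎ Φ≤ s′ s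
  Φ-total s s′ with <-cmp (degree s) (degree s′)
  ... | tri< D<D′ _ _ = inj₁ (Φ≤-smaller-degree s s′ D<D′)
  ... | tri> _ _ D′<D = inj₂ (Φ≤-smaller-degree s′ s D′<D)
  ... | tri≈ _ D≡D′ _ = Sum.map (Φ≤-equal-degree s s′ D≡D′) (Φ≤-equal-degree s′ s (≡.sym D≡D′)) (F-total s s′)

  -- Existence of the decomposition

  factor-shape : ∀ qs → All Prime qs → ∃[ t ] ∃[ ps ] Shape (product qs) t ps
  factor-shape [] [] = 1 , [] , unit
  factor-shape (q ∷ qs) (pq ∷ primes) with t , ps , s ← factor-shape qs primes | q ∈? ps
  ... | yes q∈ = q * t , ps , old pq q∈ s
  ... | no q∉  = t , q ∷ ps , new pq q∉ s

  shape : ∀ n .{{_ : NonZero n}} → ∃[ t ] ∃[ ps ] Shape n t ps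
  shape n with factorise n
  ... | record { factors = qs ; isFactorisation = refl ; factorsPrime = primes } = factor-shape qs primes

open Ordering

-- Return to the field

open import Data.Integer.Base using (ℤ; +_; _≤_; +≤+)

module _ {c ℓ₁ ℓ₂} (K : HeytingField c ℓ₁ ℓ₂) (char0 : Cyclotomic.CharacteristicZero K) where
  open Cyclotomic K
  open Roots K char0 using (Φ-value)

  Φ≤⇒≤ᶻ : ∀ {m t ps} (s : Shape m t ps) {n t′ ps′} (s′ : Shape n t′ ps′) {ζₘ ζₙ} →
          IsPrimitiveRoot m ζₘ → IsPrimitiveRoot n ζₙ → Φ≤ s s′ →
          ∀ q → + 2 ≤ q → Φ m ζₘ (ι q) ≤ᶻ Φ n ζₙ (ι q)
  Φ≤⇒≤ᶻ s s′ primₘ primₙ Φ≤Φ (+ q) (+≤+ 2≤q) =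
    let V  , _ , quot  , eq  = Φ-value s primₘ q 2≤q
        V′ , _ , quot′ , eq′ = Φ-value s′ primₙ q 2≤q
    in + V , + V′ , eq , eq′ , +≤+ (Φ≤Φ q 2≤q quot quot′)

mainTheorem2 : ∀ {c ℓ₁ ℓ₂} (K : HeytingField c ℓ₁ ℓ₂) →
    let open HeytingField K using (Carrier)
        open Cyclotomic K
    in CharacteristicZero →
       (m n : ℕ) .{{_ : NonZero m}} .{{_ : NonZero n}} →
       (ζₘ ζₙ : Carrier) → IsPrimitiveRoot m ζₘ → IsPrimitiveRoot n ζₙ →
       (∀ (q : ℤ) → + 2 ≤ q → Φ m ζₘ (ι q) ≤ᶻ Φ n ζₙ (ι q)) ⊎
       (∀ (q : ℤ) → + 2 ≤ q → Φ n ζₙ (ι q) ≤ᶻ Φ m ζₘ (ι q))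
mainTheorem2 K char0 m n ζₘ ζₙ primₘ primₙ =
  let _ , _ , s  = shape m
      _ , _ , s′ = shape n
  in Sum.map (Φ≤⇒≤ᶻ K char0 s s′ primₘ primₙ) (Φ≤⇒≤ᶻ K char0 s′ s primₙ primₘ) (Φ-total s s′)
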